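{- Let $G$ be a finite Abelian group with $|G| \ge 2$, let $m$ and $K$ be positive integers, and suppose that $A_1,\ldots,A_{2K} \subseteq G$ satisfy $mA_i = G$ for all $1 \le i \le 2K$. If $K \ge m \ln \log_2(|G|)$, then $A_1+\cdots+A_{2K}=G$. Moreover, for $m=2$, the same conclusion $A_1+\cdots+A_{2K}=G$ holds under the condition $K \ge \log_2 \log_2(|G|)$ in place of $K \ge m \ln \log_2(|G|)$.
   Context: For subsets $A,B$ of an Abelian group $G$ (written additively), the sumset is $A+B=\{a+b : a\in A,\ b\in B\}$, and $A_1+\cdots+A_k$ denotes the iterated sumset. For $A\subseteq G$ and a positive integer $m$, $mA = A+\cdots+A$ ($m$ summands) denotes the $m$-fold sumset of $A$ (not the dilate of $A$). Here $\ln$ is the natural logarithm and $\log_2$ is the logarithm in base $2$. -}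

module Defs where

open import Algebra.Bundles using (AbelianGroup)
import Algebra.Definitions.RawSemiring as RawSemiringDefs
import Algebra.Properties.CommutativeMonoid.Sum as Sum
open import Data.Fin.Base using (Fin)
open import Data.Integer.Base using (ℤ; +_; -[1+_])
open import Data.Nat.Base as ℕ using (ℕ; zero; suc; NonZero; _!)
open import Data.Nat.Properties using (_!≢0)
open import Data.Product.Base using (∃-syntax; _×_)
open import Data.Rational.Base
  using (ℚ; 0ℚ; 1ℚ; ½; _/_; _+_; _*_; _<_; _≤_; ↥_; ↧ₙ_; +-*-rawSemiring)
open import Data.Vec.Functional using (Vector; replicate)
open import Function.Bundles using (Inverse)
open import Level using (Level; 0ℓ; _⊔_)
open import Relation.Binary.PropositionalEquality.Properties using (setoid)
open import Relation.Unary using (Pred; _∈_; _⊆_)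

open RawSemiringDefs +-*-rawSemiring using (_^_)

private
  variable
    p : Level

-- Sumsets

module _ {c ℓ} (G : AbelianGroup c ℓ) where
  open AbelianGroup G using (Carrier; _≈_; commutativeMonoid)
    renaming (setoid to G-setoid)
  open Sum commutativeMonoid using (sum)

  HasOrder : ℕ → Set (c ⊔ ℓ)
  HasOrder n = Inverse G-setoid (setoid (Fin n))

  -- A₁ + ⋯ + Aₖ
  sumset : ∀ {k} → Vector (Pred Carrier p) k → Pred Carrier (c ⊔ ℓ ⊔ p)
  sumset A g = ∃[ a ] (∀ i → a i ∈ A i) × g ≈ sum a

  -- mA, the m-fold sumset (not the dilate)
  foldSumset : ℕ → Pred Carrier p → Pred Carrier (c ⊔ ℓ ⊔ p)
  foldSumset m A = sumset (replicate m A)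

-- Real numbers as lower Dedekind cuts: the real x is represented by the set
-- of rationals q < x, and the order is inclusion.  The cut axioms (inhabited,
-- bounded, downward closed, open) are not bundled; the operations below
-- compute the cut of the intended real whenever their argument is a genuine
-- cut, with log₂ x and ln x being the empty cut (-∞) when x ≤ 0.

LowerCut : Set₁
LowerCut = Pred ℚ 0ℓ

infix 4 _≤ᶜ_ _≥ᶜ_

_≤ᶜ_ _≥ᶜ_ : LowerCut → LowerCut → Set
x ≤ᶜ y = x ⊆ y
x ≥ᶜ y = y ≤ᶜ x

fromℕ : ℕ → LowerCut
fromℕ n q = q < + n / 1

-- q < m x  ⇔  q / m < x
infixr 7 _·_

_·_ : (m : ℕ) .{{_ : NonZero m}} → LowerCut → LowerCut
(m · x) q = q * (+ 1 / m) ∈ x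

2^ : ℤ → ℚ
2^ (+ n)    = (+ 2 / 1) ^ n
2^ -[1+ n ] = ½ ^ suc n

-- 2^q ≤ s for rational q = a / d: s is positive and 2^a ≤ s^d
TwoPow≤ : ℚ → ℚ → Set
TwoPow≤ q s = 0ℚ < s × 2^ (↥ q) ≤ s ^ (↧ₙ q)

expPartialSum : ℚ → ℕ → ℚ
expPartialSum q zero    = 1ℚ
expPartialSum q (suc n) =
  expPartialSum q n + q ^ suc n * _/_ (+ 1) (suc n !) {{suc n !≢0}}

-- e^q ≤ s for rational q, where e^q is the limit of the partial sums
-- of its Taylor series
Exp≤ : ℚ → ℚ → Set
Exp≤ q s = ∀ ε → 0ℚ < ε →
  ∃[ n₀ ] ∀ n → n₀ ℕ.≤ n → expPartialSum q n < s + ε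

-- q < log₂ x  ⇔  2^q < x  ⇔  2^q ≤ s for some rational s < x
log₂ : LowerCut → LowerCut
log₂ x q = ∃[ s ] s ∈ x × TwoPow≤ q s

-- q < ln x  ⇔  e^q < x  ⇔  e^q ≤ s for some rational s < x
ln : LowerCut → LowerCut
ln x q = ∃[ s ] s ∈ x × Exp≤ q s

{-# OPTIONS --safe #-}

-- Let |G| = n.  By the Plünnecke–Ruzsa inequality (in Petridis' form), mA = G
-- implies |B + A| ^ m ≥ n |B| ^ (m − 1) for all nonempty B.  Moreover
-- |A| ^ m > n, strictly, when m ≥ 2: A + A has fewer than |A| ^ 2 elements, by
-- commutativity.  By induction on K, S = A₁ + ⋯ + A_K satisfies
--   n ^ (m ^ K) < |S| ^ (m ^ K) · n ^ ((m − 1) ^ K).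
-- If 2 |S| ≤ n, this gives log₂ n > (m / (m − 1)) ^ K, which is at least
-- e ^ (K / m), and is 2 ^ K for m = 2; this contradicts the bound on K.  So
-- A₁ + ⋯ + A_K and A_{K+1} + ⋯ + A_{2K} both fill more than half of G, and
-- the pigeonhole principle shows that their sum is G.
module Submission where

open import Defs

-- The bound on K admits equality, and for m = 2 equality occurs, for example with |G| = 4 and K =
-- 1. There r ^ K with r = m / (m - 1) is exactly 2 ^ K, so a weak inequality log₂ n ≥ r ^ K would
-- contradict nothing. Hence the insistence on |A| ^ m > n: this single strict inequality is carried
-- through the whole induction. No logarithm is evaluated. The bound on K is an inclusion of cuts,
-- and it is refuted by one rational, K itself, which lies in the right-hand cut but not strictly
-- below K. Membership unfolds to inequalities between powers of rationals and partial sums of the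
-- exponential series. The `A i` are arbitrary predicates, without decidable membership or a size.
-- All counting therefore takes place in lists extracted from the proofs that m-fold sumsets are
-- everything, over a copy of the group on `Fin n`.

private module Cuts where

  import Algebra.Definitions.RawSemiring as RawSemiringDefs
  open import Algebra.Bundles using (CommutativeRing)
  import Algebra.Properties.CommutativeSemiring.Exp as Exp
  open import Data.Integer.Base as ℤ using (ℤ; +_; -[1+_])
  import Data.Integer.Properties as ℤ
  open import Data.Nat.Base as ℕ using (ℕ; zero; suc; NonZero; _!; z≤n; s≤s)
  import Data.Nat.Coprimality as Coprimality
  import Data.Nat.Properties as ℕ
  open import Data.Product.Base using (_,_; ∃-syntax; _×_)
  open import Data.Rational.Base hiding (NonZero)
  open import Data.Rational.Properties
  open import Data.Rational.Solver using (module +-*-Solver)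
  open import Data.Rational.Unnormalised.Base as ℚᵘ using (mkℚᵘ; *≡*; *<*)
  import Data.Rational.Unnormalised.Properties as ℚᵘ
  open import Function.Base using (it)
  open import Relation.Binary.PropositionalEquality
  open import Relation.Nullary.Negation.Core using (¬_)

  open RawSemiringDefs +-*-rawSemiring using (_^_)
  open Exp (CommutativeRing.commutativeSemiring +-*-commutativeRing) using (^-distrib-*)
  open +-*-Solver

  -- Naturals as rationals, and order arithmetic of rationals.

  ι : ℕ → ℚ
  ι n = + n / 1

  ι≡mkℚ : ∀ n → ι n ≡ mkℚ (+ n) 0 (Coprimality.sym (Coprimality.1-coprimeTo n))
  ι≡mkℚ n = normalize-coprime (Coprimality.sym (Coprimality.1-coprimeTo n))

  toℚᵘ-ι : ∀ n → toℚᵘ (ι n) ≡ mkℚᵘ (+ n) 0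
  toℚᵘ-ι n = cong toℚᵘ (ι≡mkℚ n)

  ι-homo-+ : ∀ m n → ι (m ℕ.+ n) ≡ ι m + ι n
  ι-homo-+ m n = toℚᵘ-injective (begin
    toℚᵘ (ι (m ℕ.+ n))                   ≡⟨ toℚᵘ-ι (m ℕ.+ n) ⟩
    mkℚᵘ (+ (m ℕ.+ n)) 0                 ≈⟨ *≡* (cong₂ (λ x y → (x ℤ.+ y) ℤ.* + 1)
                                              (sym (ℤ.*-identityʳ (+ m))) (sym (ℤ.*-identityʳ (+ n)))) ⟩
    mkℚᵘ (+ m) 0 ℚᵘ.+ mkℚᵘ (+ n) 0       ≡⟨ cong₂ ℚᵘ._+_ (toℚᵘ-ι m) (toℚᵘ-ι n) ⟨
    toℚᵘ (ι m) ℚᵘ.+ toℚᵘ (ι n)           ≈⟨ toℚᵘ-homo-+ (ι m) (ι n) ⟨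
    toℚᵘ (ι m + ι n)                     ∎)
    where open ℚᵘ.≃-Reasoning

  ι-homo-* : ∀ m n → ι (m ℕ.* n) ≡ ι m * ι n
  ι-homo-* m n = toℚᵘ-injective (begin
    toℚᵘ (ι (m ℕ.* n))                   ≡⟨ toℚᵘ-ι (m ℕ.* n) ⟩
    mkℚᵘ (+ (m ℕ.* n)) 0                 ≡⟨ cong (λ x → mkℚᵘ x 0) (ℤ.pos-* m n) ⟩
    mkℚᵘ (+ m) 0 ℚᵘ.* mkℚᵘ (+ n) 0       ≡⟨ cong₂ ℚᵘ._*_ (toℚᵘ-ι m) (toℚᵘ-ι n) ⟨
    toℚᵘ (ι m) ℚᵘ.* toℚᵘ (ι n)           ≈⟨ toℚᵘ-homo-* (ι m) (ι n) ⟨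
    toℚᵘ (ι m * ι n)                     ∎)
    where open ℚᵘ.≃-Reasoning

  ι-homo-^ : ∀ m k → ι (m ℕ.^ k) ≡ ι m ^ k
  ι-homo-^ m zero    = refl
  ι-homo-^ m (suc k) = trans (ι-homo-* m (m ℕ.^ k)) (cong (ι m *_) (ι-homo-^ m k))

  ι-mono-< : ∀ {m n} → m ℕ.< n → ι m < ι n
  ι-mono-< {m} {n} m<n = subst₂ _<_ (sym (ι≡mkℚ m)) (sym (ι≡mkℚ n))
    (*<* (ℤ.*-monoʳ-<-pos (+ 1) (ℤ.+<+ m<n)))

  0≤ι : ∀ n → 0ℚ ≤ ι n
  0≤ι n = nonNegative⁻¹ (ι n) {{normalize-nonNeg n 1}}

  infix 9 _⁻¹

  _⁻¹ : ∀ n .{{_ : NonZero n}} → ℚ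
  n ⁻¹ = + 1 / n

  ι*⁻¹ : ∀ n .{{_ : NonZero n}} → ι n * n ⁻¹ ≡ 1ℚ
  ι*⁻¹ n@(suc n-1) = toℚᵘ-injective (begin
    toℚᵘ (ι n * n ⁻¹)                    ≈⟨ toℚᵘ-homo-* (ι n) (n ⁻¹) ⟩
    toℚᵘ (ι n) ℚᵘ.* toℚᵘ (n ⁻¹)          ≈⟨ ℚᵘ.*-cong (ℚᵘ.≃-reflexive (toℚᵘ-ι n)) (toℚᵘ-fromℚᵘ (mkℚᵘ (+ 1) n-1)) ⟩
    mkℚᵘ (+ n) 0 ℚᵘ.* mkℚᵘ (+ 1) n-1     ≈⟨ *≡* (trans (ℤ.*-identityʳ _) (trans (ℤ.*-identityʳ (+ n))
                                         (sym (trans (ℤ.*-identityˡ _) (cong +_ (ℕ.+-identityʳ n)))))) ⟩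
    toℚᵘ 1ℚ                              ∎)
    where open ℚᵘ.≃-Reasoning

  0≤⁻¹ : ∀ n .{{_ : NonZero n}} → 0ℚ ≤ n ⁻¹
  0≤⁻¹ n = nonNegative⁻¹ (n ⁻¹) {{normalize-nonNeg 1 n}}

  0<⁻¹ : ∀ n .{{_ : NonZero n}} → 0ℚ < n ⁻¹
  0<⁻¹ n = positive⁻¹ (n ⁻¹) {{normalize-pos 1 n}}

  *-monoˡ-≤ : ∀ {p q r} → 0ℚ ≤ r → p ≤ q → r * p ≤ r * q
  *-monoˡ-≤ {r = r} 0≤r = *-monoˡ-≤-nonNeg r {{nonNegative 0≤r}}

  *-monoʳ-≤ : ∀ {p q r} → 0ℚ ≤ r → p ≤ q → p * r ≤ q * r
  *-monoʳ-≤ {r = r} 0≤r = *-monoʳ-≤-nonNeg r {{nonNegative 0≤r}}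

  0≤* : ∀ {p q} → 0ℚ ≤ p → 0ℚ ≤ q → 0ℚ ≤ p * q
  0≤* {p} {q} 0≤p 0≤q = subst (_≤ p * q) (*-zeroʳ p) (*-monoˡ-≤ 0≤p 0≤q)

  0<* : ∀ {p q} → 0ℚ < p → 0ℚ < q → 0ℚ < p * q
  0<* {p} {q} 0<p 0<q = subst (_< p * q) (*-zeroʳ p) (*-monoʳ-<-pos p {{positive 0<p}} 0<q)

  0≤+ : ∀ {p q} → 0ℚ ≤ p → 0ℚ ≤ q → 0ℚ ≤ p + q
  0≤+ = +-mono-≤

  0≤^ : ∀ {p} n → 0ℚ ≤ p → 0ℚ ≤ p ^ n
  0≤^ zero    0≤p = 0≤ι 1
  0≤^ (suc n) 0≤p = 0≤* 0≤p (0≤^ n 0≤p)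

  0<^ : ∀ {p} n → 0ℚ < p → 0ℚ < p ^ n
  0<^ zero    0<p = ι-mono-< {0} {1} (s≤s z≤n)
  0<^ (suc n) 0<p = 0<* 0<p (0<^ n 0<p)

  ^-mono-≤ : ∀ {p q} n → 0ℚ ≤ p → p ≤ q → p ^ n ≤ q ^ n
  ^-mono-≤         zero    0≤p p≤q = ≤-refl
  ^-mono-≤ {p} {q} (suc n) 0≤p p≤q = ≤-trans
    (*-monoˡ-≤ 0≤p (^-mono-≤ n 0≤p p≤q))
    (*-monoʳ-≤ (0≤^ n (≤-trans 0≤p p≤q)) p≤q)

  +-cancelʳ-≤ : ∀ r {p q} → p + r ≤ q + r → p ≤ q
  +-cancelʳ-≤ r {p} {q} p+r≤q+r = subst₂ _≤_ (cancel p) (cancel q) (+-monoˡ-≤ (- r) p+r≤q+r)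
    where
    cancel : ∀ p → p + r + - r ≡ p
    cancel p = trans (+-assoc p r (- r)) (trans (cong (λ x → p + x) (+-inverseʳ r)) (+-identityʳ p))

  -- Rational roots and membership in the cut of log₂.

  -- With z = 1 - y this is (1 - y) ^ d ≥ 1 - d y, the subtractions moved across; the step uses only
  -- z ≤ 1.
  bernoulli : ∀ {y z} → 0ℚ ≤ y → 0ℚ ≤ z → z + y ≡ 1ℚ → ∀ d → 1ℚ ≤ z ^ d + ι d * y
  bernoulli {y} {z} 0≤y 0≤z z+y≡1 zero = ≤-reflexive (sym (cong (λ t → 1ℚ + t) (*-zeroˡ y)))
  bernoulli {y} {z} 0≤y 0≤z z+y≡1 (suc d) = begin
    1ℚ                                 ≡⟨ z+y≡1 ⟨
    z + y                              ≡⟨ cong (_+ y) (*-identityʳ z) ⟨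
    z * 1ℚ + y                         ≤⟨ +-monoˡ-≤ y (*-monoˡ-≤ 0≤z (bernoulli 0≤y 0≤z z+y≡1 d)) ⟩
    z * (z ^ d + dy) + y               ≡⟨ cong (_+ y) (*-distribˡ-+ z (z ^ d) dy) ⟩
    z ^ suc d + z * dy + y             ≤⟨ +-monoˡ-≤ y (+-monoʳ-≤ (z ^ suc d) (*-monoʳ-≤ (0≤* (0≤ι d) 0≤y) z≤1)) ⟩
    z ^ suc d + 1ℚ * dy + y            ≡⟨ solve 3 (λ a d y → a :+ con 1ℚ :* (d :* y) :+ y := a :+ (con 1ℚ :+ d) :* y)
                                            refl (z ^ suc d) (ι d) y ⟩
    z ^ suc d + (1ℚ + ι d) * y         ≡⟨ cong (λ t → z ^ suc d + t * y) (ι-homo-+ 1 d) ⟨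
    z ^ suc d + ι (suc d) * y          ∎
    where
    open ≤-Reasoning
    dy = ι d * y
    z≤1 : z ≤ 1ℚ
    z≤1 = subst₂ _≤_ (+-identityʳ z) z+y≡1 (+-monoʳ-≤ z 0≤y)

  -- The root is approximated by n z with z = 1 − (D − P) / (d D) and D = n ^ d;
  -- Bernoulli's inequality gives z ^ d ≥ 1 − (D − P) / D.
  rational-root : ∀ n P d .{{_ : NonZero n}} .{{_ : NonZero P}} .{{_ : NonZero d}} → P ℕ.< n ℕ.^ d →
                  ∃[ s ] s < ι n × 0ℚ < s × ι P ≤ s ^ d
  rational-root n P d@(suc d-1) P<D =
    ι n * z , nz<n , 0<* 0<n 0<z , +-cancelʳ-≤ (ι g) P+g≤
    where
    D = n ℕ.^ d
    g = D ℕ.∸ P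
    e = d ℕ.* D ℕ.∸ g
    instance
      D≢0 : NonZero D
      D≢0 = ℕ.m^n≢0 n d
      dD≢0 : NonZero (d ℕ.* D)
      dD≢0 = ℕ.m*n≢0 d D
    u = (d ℕ.* D) ⁻¹
    z = ι e * u
    y = ι g * u

    0<n : 0ℚ < ι n
    0<n = ι-mono-< (ℕ.>-nonZero⁻¹ n)

    -- Positivity of P gives g < D, so the truncated subtraction in `e` is exact and z is positive.
    g<dD : g ℕ.< d ℕ.* D
    g<dD = ℕ.<-≤-trans (ℕ.∸-monoʳ-< {D} (ℕ.>-nonZero⁻¹ P) (ℕ.<⇒≤ P<D)) (ℕ.m≤m+n D _)

    0<z : 0ℚ < z
    0<z = 0<* (ι-mono-< (ℕ.m<n⇒0<n∸m g<dD)) (0<⁻¹ (d ℕ.* D))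

    0<y : 0ℚ < y
    0<y = 0<* (ι-mono-< (ℕ.m<n⇒0<n∸m P<D)) (0<⁻¹ (d ℕ.* D))

    z+y≡1 : z + y ≡ 1ℚ
    z+y≡1 = begin
      ι e * u + ι g * u       ≡⟨ *-distribʳ-+ u (ι e) (ι g) ⟨
      (ι e + ι g) * u         ≡⟨ cong (_* u) (ι-homo-+ e g) ⟨
      ι (e ℕ.+ g) * u         ≡⟨ cong (λ x → ι x * u) (ℕ.m∸n+n≡m (ℕ.<⇒≤ g<dD)) ⟩
      ι (d ℕ.* D) * u         ≡⟨ ι*⁻¹ (d ℕ.* D) ⟩
      1ℚ                      ∎
      where open ≡-Reasoning

    nz<n : ι n * z < ι n
    nz<n = begin-strict
      ι n * z                 ≡⟨ +-identityʳ (ι n * z) ⟨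
      ι n * z + 0ℚ            <⟨ +-monoʳ-< (ι n * z) (0<* 0<n 0<y) ⟩
      ι n * z + ι n * y       ≡⟨ *-distribˡ-+ (ι n) z y ⟨
      ι n * (z + y)           ≡⟨ trans (cong (ι n *_) z+y≡1) (*-identityʳ (ι n)) ⟩
      ι n                     ∎
      where open ≤-Reasoning

    P+g≤ : ι P + ι g ≤ (ι n * z) ^ d + ι g
    P+g≤ = begin
      ι P + ι g                           ≡⟨ ι-homo-+ P g ⟨
      ι (P ℕ.+ g)                         ≡⟨ cong ι (ℕ.m+[n∸m]≡n (ℕ.<⇒≤ P<D)) ⟩
      ι D                                 ≡⟨ *-identityʳ (ι D) ⟨
      ι D * 1ℚ                            ≤⟨ *-monoˡ-≤ (0≤ι D) (bernoulli (<⇒≤ 0<y) (<⇒≤ 0<z) z+y≡1 d) ⟩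
      ι D * (z ^ d + ι d * (ι g * u))     ≡⟨ solve 5 (λ D′ zd d′ g′ u′ → D′ :* (zd :+ d′ :* (g′ :* u′)) :=
                                               D′ :* zd :+ g′ :* (d′ :* D′ :* u′)) refl (ι D) (z ^ d) (ι d) (ι g) u ⟩
      ι D * z ^ d + ι g * (ι d * ι D * u) ≡⟨ cong₂ _+_
                                               (trans (cong (_* z ^ d) (ι-homo-^ n d)) (sym (^-distrib-* (ι n) z d)))
                                               (trans (cong (λ x → ι g * x) (trans (cong (_* u) (sym (ι-homo-* d D))) (ι*⁻¹ (d ℕ.* D))))
                                                 (*-identityʳ (ι g))) ⟩
      (ι n * z) ^ d + ι g                 ∎
      where open ≤-Reasoning

  cross-multiply : ∀ s L M → s * ι L ≡ ι M → ↥ s ℤ.* + L ≡ + M ℤ.* ↧ s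
  cross-multiply s@(mkℚ _ d-1 _) L M s*L≡M = begin
    ↥ s ℤ.* + L                   ≡⟨ ℤ.*-identityʳ _ ⟨
    ↥ s ℤ.* + L ℤ.* + 1           ≡⟨ ℚᵘ.drop-*≡* s*L≃M ⟩
    + M ℤ.* + (suc d-1 ℕ.* 1)     ≡⟨ cong (λ d → + M ℤ.* + d) (ℕ.*-identityʳ (suc d-1)) ⟩
    + M ℤ.* ↧ s                   ∎
    where
    open ≡-Reasoning
    s*L≃M : toℚᵘ s ℚᵘ.* mkℚᵘ (+ L) 0 ℚᵘ.≃ mkℚᵘ (+ M) 0
    s*L≃M = subst₂ (λ x y → toℚᵘ s ℚᵘ.* x ℚᵘ.≃ y) (toℚᵘ-ι L) (toℚᵘ-ι M)
      (ℚᵘ.≃-trans (ℚᵘ.≃-sym (toℚᵘ-homo-* s (ι L))) (toℚᵘ-cong s*L≡M))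

  0≤⇒↥≡+ : ∀ s → 0ℚ ≤ s → ↥ s ≡ + ℤ.∣ ↥ s ∣
  0≤⇒↥≡+ (mkℚ (+ _) _ _)    _   = refl
  0≤⇒↥≡+ (mkℚ -[1+ _ ] _ _) 0≤s with () ← nonNegative 0≤s

  -- `TwoPow≤` reads numerator and denominator in lowest terms, so M / L has to be traded for the
  -- reduced a / d, using a L = M d. Strictness survives the trade and leaves room for a rational t
  -- below n with 2 ^ a ≤ t ^ d.
  ratio∈log₂ : ∀ n M L .{{_ : NonZero n}} → 2 ℕ.^ M ℕ.< n ℕ.^ L →
               ∀ s → 0ℚ ≤ s → s * ι L ≡ ι M → log₂ (fromℕ n) s
  ratio∈log₂ n M L 2^M<n^L s 0≤s s*L≡M =
    let t , t<n , 0<t , 2^a≤t^d = rational-root n (2 ℕ.^ a) d {{it}} {{ℕ.m^n≢0 2 a}} 2^a<n^d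
    in t , t<n , 0<t , subst (_≤ t ^ d) (trans (ι-homo-^ 2 a) (cong 2^ (sym ↥s≡a))) 2^a≤t^d
    where
    a = ℤ.∣ ↥ s ∣
    d = ↧ₙ s
    ↥s≡a = 0≤⇒↥≡+ s 0≤s

    aL≡Md : a ℕ.* L ≡ M ℕ.* d
    aL≡Md = ℤ.+-injective (begin
      + (a ℕ.* L)     ≡⟨ ℤ.pos-* a L ⟩
      + a ℤ.* + L     ≡⟨ cong (ℤ._* + L) ↥s≡a ⟨
      ↥ s ℤ.* + L     ≡⟨ cross-multiply s L M s*L≡M ⟩
      + M ℤ.* ↧ s     ≡⟨ ℤ.pos-* M d ⟨
      + (M ℕ.* d)     ∎)
      where open ≡-Reasoning

    2^a<n^d : 2 ℕ.^ a ℕ.< n ℕ.^ d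
    -- Raising the reverse inequality to the power L and the hypothesis to the power d makes the
    -- exponents of 2 agree.
    2^a<n^d = ℕ.≰⇒> λ n^d≤2^a → ℕ.<-irrefl refl (begin-strict
      (n ℕ.^ L) ℕ.^ d     ≡⟨ ^-swap n L d ⟩
      (n ℕ.^ d) ℕ.^ L     ≤⟨ ℕ.^-monoˡ-≤ L n^d≤2^a ⟩
      (2 ℕ.^ a) ℕ.^ L     ≡⟨ ℕ.^-*-assoc 2 a L ⟩
      2 ℕ.^ (a ℕ.* L)     ≡⟨ cong (2 ℕ.^_) aL≡Md ⟩
      2 ℕ.^ (M ℕ.* d)     ≡⟨ ℕ.^-*-assoc 2 M d ⟨
      (2 ℕ.^ M) ℕ.^ d     <⟨ ℕ.^-monoˡ-< d 2^M<n^L ⟩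
      (n ℕ.^ L) ℕ.^ d     ∎)
      where
      open ℕ.≤-Reasoning
      ^-swap : ∀ x i j → (x ℕ.^ i) ℕ.^ j ≡ (x ℕ.^ j) ℕ.^ i
      ^-swap x i j = trans (ℕ.^-*-assoc x i j)
        (trans (cong (x ℕ.^_) (ℕ.*-comm i j)) (sym (ℕ.^-*-assoc x j i)))

  -- Upper bounds for the exponential series.

  -- The mean value estimate for the power function on the interval from q to q + x, with the
  -- derivative taken at the right end, where it is largest.
  suc-power-bound : ∀ {q x} → 0ℚ ≤ q → 0ℚ ≤ x → ∀ j →
                    (q + x) ^ suc j ≤ q ^ suc j + ι (suc j) * (x * (q + x) ^ j)
  suc-power-bound {q} {x} 0≤q 0≤x zero = ≤-reflexive
    (solve 2 (λ q x → (q :+ x) :* con 1ℚ := q :* con 1ℚ :+ con 1ℚ :* (x :* con 1ℚ)) refl q x)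
  suc-power-bound {q} {x} 0≤q 0≤x (suc j) = begin
    v * v ^ suc j
      ≤⟨ *-monoˡ-≤ (0≤+ 0≤q 0≤x) (suc-power-bound 0≤q 0≤x j) ⟩
    v * (q ^ suc j + ι (suc j) * (x * v ^ j))
      ≡⟨ solve 5 (λ q x Q k V → (q :+ x) :* (Q :+ k :* (x :* V)) :=
           x :* Q :+ (q :* Q :+ k :* (x :* ((q :+ x) :* V)))) refl q x (q ^ suc j) (ι (suc j)) (v ^ j) ⟩
    x * q ^ suc j + (q ^ (2 ℕ.+ j) + ι (suc j) * (x * v ^ suc j))
      ≤⟨ +-monoˡ-≤ _ (*-monoˡ-≤ 0≤x (^-mono-≤ (suc j) 0≤q q≤v)) ⟩
    x * v ^ suc j + (q ^ (2 ℕ.+ j) + ι (suc j) * (x * v ^ suc j))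
      ≡⟨ solve 3 (λ a Q k → a :+ (Q :+ k :* a) := Q :+ (con 1ℚ :+ k) :* a) refl
           (x * v ^ suc j) (q ^ (2 ℕ.+ j)) (ι (suc j)) ⟩
    q ^ (2 ℕ.+ j) + (1ℚ + ι (suc j)) * (x * v ^ suc j)
      ≡⟨ cong (λ t → q ^ (2 ℕ.+ j) + t * (x * v ^ suc j)) (ι-homo-+ 1 (suc j)) ⟨
    q ^ (2 ℕ.+ j) + ι (2 ℕ.+ j) * (x * v ^ suc j) ∎
    where
    open ≤-Reasoning
    v = q + x
    q≤v : q ≤ v
    q≤v = subst (_≤ v) (+-identityʳ q) (+-monoʳ-≤ q 0≤x)

  infix 9 _!⁻¹

  _!⁻¹ : ℕ → ℚ
  n !⁻¹ = _⁻¹ (n !) {{ℕ._!≢0 n}}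

  0≤!⁻¹ : ∀ n → 0ℚ ≤ n !⁻¹
  0≤!⁻¹ n = 0≤⁻¹ (n !) {{ℕ._!≢0 n}}

  suc*!⁻¹ : ∀ n → ι (suc n) * suc n !⁻¹ ≡ n !⁻¹
  suc*!⁻¹ n = begin
    s * i′                ≡⟨ *-identityˡ _ ⟨
    1ℚ * (s * i′)         ≡⟨ cong (_* (s * i′)) (ι*⁻¹ (n !) {{ℕ._!≢0 n}}) ⟨
    f * i * (s * i′)      ≡⟨ solve 4 (λ f i s i′ → f :* i :* (s :* i′) := i :* (s :* f :* i′)) refl f i s i′ ⟩
    i * (s * f * i′)      ≡⟨ cong (λ t → i * (t * i′)) (ι-homo-* (suc n) (n !)) ⟨
    i * (ι (suc n !) * i′) ≡⟨ cong (i *_) (ι*⁻¹ (suc n !) {{ℕ._!≢0 (suc n)}}) ⟩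
    i * 1ℚ                ≡⟨ *-identityʳ i ⟩
    i                     ∎
    where
    open ≡-Reasoning
    s = ι (suc n)
    f = ι (n !)
    i = n !⁻¹
    i′ = suc n !⁻¹

  -- Division by the factorial turns the derivative of one Taylor term into the preceding Taylor
  -- term.
  exp-term-bound : ∀ {q x} → 0ℚ ≤ q → 0ℚ ≤ x → ∀ j →
    (q + x) ^ suc j * suc j !⁻¹ ≤ q ^ suc j * suc j !⁻¹ + x * ((q + x) ^ j * j !⁻¹)
  exp-term-bound {q} {x} 0≤q 0≤x j = begin
    v ^ suc j * i′                        ≤⟨ *-monoʳ-≤ (0≤!⁻¹ (suc j)) (suc-power-bound 0≤q 0≤x j) ⟩
    (Q + k * (x * v ^ j)) * i′            ≡⟨ solve 5 (λ Q k x V i′ → (Q :+ k :* (x :* V)) :* i′ :=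
                                               Q :* i′ :+ x :* (V :* (k :* i′))) refl Q k x (v ^ j) i′ ⟩
    Q * i′ + x * (v ^ j * (k * i′))       ≡⟨ cong (λ t → Q * i′ + x * (v ^ j * t)) (suc*!⁻¹ j) ⟩
    Q * i′ + x * (v ^ j * j !⁻¹)          ∎
    where
    open ≤-Reasoning
    v = q + x
    Q = q ^ suc j
    k = ι (suc j)
    i′ = suc j !⁻¹

  exp-step-suc : ∀ {q x} → 0ℚ ≤ q → 0ℚ ≤ x → ∀ n →
    expPartialSum (q + x) (suc n) ≤ expPartialSum q (suc n) + x * expPartialSum (q + x) n
  exp-step-suc {q} {x} 0≤q 0≤x zero = begin
    1ℚ + (q + x) ^ 1 * 1 !⁻¹                       ≤⟨ +-monoʳ-≤ 1ℚ (exp-term-bound 0≤q 0≤x 0) ⟩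
    1ℚ + (q ^ 1 * 1 !⁻¹ + x * (1ℚ * 1ℚ))           ≡⟨ +-assoc 1ℚ (q ^ 1 * 1 !⁻¹) (x * 1ℚ) ⟨
    1ℚ + q ^ 1 * 1 !⁻¹ + x * 1ℚ                    ∎
    where open ≤-Reasoning
  exp-step-suc {q} {x} 0≤q 0≤x (suc n) = begin
    P (q + x) (suc n) + T (q + x) (2 ℕ.+ n)
      ≤⟨ +-mono-≤ (exp-step-suc 0≤q 0≤x n) (exp-term-bound 0≤q 0≤x (suc n)) ⟩
    P q (suc n) + x * P (q + x) n + (T q (2 ℕ.+ n) + x * T (q + x) (suc n))
      ≡⟨ solve 5 (λ a x b c d → a :+ x :* b :+ (c :+ x :* d) := a :+ c :+ x :* (b :+ d)) refl
           (P q (suc n)) x (P (q + x) n) (T q (2 ℕ.+ n)) (T (q + x) (suc n)) ⟩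
    P q (suc n) + T q (2 ℕ.+ n) + x * (P (q + x) n + T (q + x) (suc n)) ∎
    where
    open ≤-Reasoning
    P = expPartialSum
    T : ℚ → ℕ → ℚ
    T v j = v ^ j * j !⁻¹

  -- Differentiation costs one index; partial sums at a nonnegative argument increase with the
  -- index, which restores it. With the same number of terms throughout, the bound (1 - x) P (q + x)
  -- ≤ P q can be iterated in steps of size x.
  exp-step : ∀ {q x} → 0ℚ ≤ q → 0ℚ ≤ x → ∀ n →
    expPartialSum (q + x) n ≤ expPartialSum q n + x * expPartialSum (q + x) n
  exp-step {q} {x} 0≤q 0≤x zero = begin
    1ℚ            ≡⟨ +-identityʳ 1ℚ ⟨
    1ℚ + 0ℚ       ≤⟨ +-monoʳ-≤ 1ℚ 0≤x ⟩
    1ℚ + x        ≡⟨ cong (λ t → 1ℚ + t) (*-identityʳ x) ⟨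
    1ℚ + x * 1ℚ   ∎
    where open ≤-Reasoning
  exp-step {q} {x} 0≤q 0≤x (suc n) = begin
    P (q + x) (suc n)                      ≤⟨ exp-step-suc 0≤q 0≤x n ⟩
    P q (suc n) + x * P (q + x) n          ≤⟨ +-monoʳ-≤ (P q (suc n)) (*-monoˡ-≤ 0≤x P≤P) ⟩
    P q (suc n) + x * P (q + x) (suc n)    ∎
    where
    open ≤-Reasoning
    P = expPartialSum
    0≤v = 0≤+ 0≤q 0≤x
    P≤P : P (q + x) n ≤ P (q + x) (suc n)
    P≤P = subst (_≤ P (q + x) (suc n)) (+-identityʳ _)
      (+-monoʳ-≤ (P (q + x) n) (0≤* (0≤^ (suc n) 0≤v) (0≤!⁻¹ (suc n))))

  exp-zero : ∀ n → expPartialSum 0ℚ n ≡ 1ℚ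
  exp-zero zero    = refl
  exp-zero (suc n) = begin
    expPartialSum 0ℚ n + 0ℚ * 0ℚ ^ n * suc n !⁻¹   ≡⟨ cong₂ (λ a b → a + b * suc n !⁻¹) (exp-zero n) (*-zeroˡ (0ℚ ^ n)) ⟩
    1ℚ + 0ℚ * suc n !⁻¹                            ≡⟨ cong (λ t → 1ℚ + t) (*-zeroˡ (suc n !⁻¹)) ⟩
    1ℚ + 0ℚ                                        ≡⟨ +-identityʳ 1ℚ ⟩
    1ℚ                                             ∎
    where open ≡-Reasoning

  -- The hypothesis on r says r = 1 / (1 − x), without division.
  exp-bound : ∀ {x r} → 0ℚ ≤ x → 0ℚ ≤ r → r ≡ 1ℚ + x * r → ∀ k n → expPartialSum (ι k * x) n ≤ r ^ k
  exp-bound {x} {r} 0≤x 0≤r r≡1+xr zero n = ≤-reflexive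
    (trans (cong (λ q → expPartialSum q n) (*-zeroˡ x)) (exp-zero n))
  exp-bound {x} {r} 0≤x 0≤r r≡1+xr (suc k) n = subst (λ q → P q n ≤ r ^ suc k) (sym sk*x≡)
    (≤-trans (+-cancelʳ-≤ (x * r * Pv) P+xrP≤) (*-monoˡ-≤ 0≤r (exp-bound 0≤x 0≤r r≡1+xr k n)))
    where
    open ≤-Reasoning
    P = expPartialSum
    q = ι k * x
    Pv = P (q + x) n
    sk*x≡ : ι (suc k) * x ≡ q + x
    sk*x≡ = trans (cong (_* x) (ι-homo-+ 1 k))
      (solve 2 (λ k x → (con 1ℚ :+ k) :* x := k :* x :+ x) refl (ι k) x)
    -- Multiplying `exp-step` by r and expanding r as 1 + x r puts the same term x r P (q + x) on
    -- both sides; cancelling it replaces the division by 1 - x.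
    P+xrP≤ : Pv + x * r * Pv ≤ r * P q n + x * r * Pv
    P+xrP≤ = begin
      Pv + x * r * Pv           ≡⟨ solve 2 (λ p a → p :+ a :* p := (con 1ℚ :+ a) :* p) refl Pv (x * r) ⟩
      (1ℚ + x * r) * Pv         ≡⟨ cong (_* Pv) r≡1+xr ⟨
      r * Pv                    ≤⟨ *-monoˡ-≤ 0≤r (exp-step (0≤* (0≤ι k) 0≤x) 0≤x n) ⟩
      r * (P q n + x * Pv)      ≡⟨ solve 4 (λ r p x v → r :* (p :+ x :* v) := r :* p :+ x :* r :* v) refl r (P q n) x Pv ⟩
      r * P q n + x * r * Pv    ∎

  -- With m = m′ + 1, the number r = m / m′ is 1 / (1 − 1 / m), and r ^ K is the
  -- witness that separates e ^ (K / m), resp. 2 ^ K, from log₂ n.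
  module _ (m′ : ℕ) .{{_ : NonZero m′}} where
    private
      m = suc m′

    r : ℚ
    r = ι m * m′ ⁻¹

    0<r : 0ℚ < r
    0<r = 0<* (ι-mono-< {0} {m} (s≤s z≤n)) (0<⁻¹ m′)

    r*m′≡m : r * ι m′ ≡ ι m
    r*m′≡m = trans (*-assoc (ι m) (m′ ⁻¹) (ι m′))
      (trans (cong (ι m *_) (trans (*-comm (m′ ⁻¹) (ι m′)) (ι*⁻¹ m′))) (*-identityʳ (ι m)))

    r≡1+r/m : r ≡ 1ℚ + m ⁻¹ * r
    r≡1+r/m = begin
      ι m * m′ ⁻¹                        ≡⟨ cong (_* m′ ⁻¹) (ι-homo-+ 1 m′) ⟩
      (1ℚ + ι m′) * m′ ⁻¹                ≡⟨ solve 2 (λ a b → (con 1ℚ :+ a) :* b := a :* b :+ con 1ℚ :* b) refl (ι m′) (m′ ⁻¹) ⟩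
      ι m′ * m′ ⁻¹ + 1ℚ * m′ ⁻¹          ≡⟨ cong₂ (λ a b → a + b * m′ ⁻¹) (ι*⁻¹ m′) (sym (ι*⁻¹ m)) ⟩
      1ℚ + ι m * m ⁻¹ * m′ ⁻¹            ≡⟨ solve 3 (λ a b c → con 1ℚ :+ a :* b :* c := con 1ℚ :+ b :* (a :* c)) refl (ι m) (m ⁻¹) (m′ ⁻¹) ⟩
      1ℚ + m ⁻¹ * (ι m * m′ ⁻¹)          ∎
      where open ≡-Reasoning

    r^K∈log₂ : ∀ n K .{{_ : NonZero n}} → 2 ℕ.^ (m ℕ.^ K) ℕ.< n ℕ.^ (m′ ℕ.^ K) →
               log₂ (fromℕ n) (r ^ K)
    r^K∈log₂ n K 2^M<n^L = ratio∈log₂ n (m ℕ.^ K) (m′ ℕ.^ K) 2^M<n^L (r ^ K) (0≤^ K (<⇒≤ 0<r)) (begin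
      r ^ K * ι (m′ ℕ.^ K)    ≡⟨ cong (r ^ K *_) (ι-homo-^ m′ K) ⟩
      r ^ K * ι m′ ^ K        ≡⟨ ^-distrib-* r (ι m′) K ⟨
      (r * ι m′) ^ K          ≡⟨ cong (_^ K) r*m′≡m ⟩
      ι m ^ K                 ≡⟨ ι-homo-^ m K ⟨
      ι (m ℕ.^ K)             ∎)
      where open ≡-Reasoning

    -- Membership of K in `m · ln (log₂ n)` asks for e ^ (K / m) ≤ s with s in the cut of log₂ n; s
    -- = r ^ K serves. It bounds every partial sum, so `n₀` is 0.
    K≱m-ln-log₂ : ∀ n K .{{_ : NonZero n}} → 2 ℕ.^ (m ℕ.^ K) ℕ.< n ℕ.^ (m′ ℕ.^ K) →
                  ¬ fromℕ K ≥ᶜ m · ln (log₂ (fromℕ n))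
    K≱m-ln-log₂ n K 2^M<n^L K≥ = <-irrefl refl (K≥ (r ^ K , r^K∈log₂ n K 2^M<n^L , λ ε 0<ε →
      0 , λ j _ → ≤-<-trans (exp-bound (0≤⁻¹ m) (<⇒≤ 0<r) r≡1+r/m K j)
        (subst (_< r ^ K + ε) (+-identityʳ (r ^ K)) (+-monoʳ-< (r ^ K) 0<ε))))

  -- For m = 2 the ratio r is 2, and `TwoPow≤` holds at r ^ K with equality: nothing is lost to the
  -- comparison with the exponential.
  K≱log₂-log₂ : ∀ n K .{{_ : NonZero n}} → 2 ℕ.^ (2 ℕ.^ K) ℕ.< n ℕ.^ (1 ℕ.^ K) →
                ¬ fromℕ K ≥ᶜ log₂ (log₂ (fromℕ n))
  K≱log₂-log₂ n K 2^M<n^L K≥ = <-irrefl refl (K≥ (ι 2 ^ K , r^K∈log₂ 1 n K 2^M<n^L , 0<^ K (0<r 1) ,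
    subst (λ k → 2^ (↥ k) ≤ (ι 2 ^ K) ^ (↧ₙ k)) (sym (ι≡mkℚ K)) (≤-reflexive (sym (*-identityʳ (ι 2 ^ K))))))

open Cuts using (K≱m-ln-log₂; K≱log₂-log₂)

open import Algebra.Bundles using (AbelianGroup; RawGroup)
open import Algebra.Core using (Op₁; Op₂)
import Algebra.Morphism.GroupMonomorphism as GroupMonomorphism
open import Algebra.Morphism.Structures using (module GroupMorphisms)
import Algebra.Properties.AbelianGroup as AbelianGroupProperties
import Algebra.Properties.CommutativeMonoid.Sum as Sum
open import Algebra.Structures using (IsAbelianGroup; IsGroup)
open import Data.Bool.Base using (Bool; true; false)
open import Data.Fin.Base using (Fin; zero; suc; _↑ˡ_; _↑ʳ_)
open import Data.Fin.Permutation using (Permutation′; _⟨$⟩ʳ_)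
import Data.Fin.Properties as Fin
open import Data.Fin.Subset
  using (Subset; _∈_; _⊆_; _⊂_; _∪_; _∩_; ⊤; ⊥; ⁅_⁆; ∣_∣; Nonempty)
open import Data.Fin.Subset.Properties
open import Data.List.Base using (List; []; _∷_; cartesianProductWith; allFin; filter)
open import Data.List.Membership.Propositional using () renaming (_∈_ to _∈ᴸ_)
open import Data.List.Membership.Propositional.Properties
  using (∈-cartesianProductWith⁺; ∈-cartesianProductWith⁻; ∈-filter⁺; ∈-filter⁻; ∈-allFin)
open import Data.List.Relation.Unary.All as All using (All; all?)
open import Data.List.Relation.Unary.Any using (here; there)
open import Data.Nat.Base
  using (ℕ; zero; suc; _+_; _*_; _^_; _≤_; _<_; z≤n; s≤s; NonZero; >-nonZero)
open import Data.Nat.Induction using (<-wellFounded; Acc; acc)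
open import Data.Nat.Properties
open import Algebra.Properties.CommutativeSemigroup *-commutativeSemigroup
  using (interchange; xy∙z≈xz∙y)
open import Data.Product.Base using (∃-syntax; ∃₂; _×_; _,_; proj₁; proj₂)
open import Data.Sum.Base using (inj₁; inj₂)
open import Data.Vec.Base using ([]; _∷_; lookup; tabulate)
open import Data.Vec.Functional as Vector using (Vector; head; tail; take; drop)
open import Data.Vec.Properties using (lookup∘tabulate; []=⇒lookup; lookup⇒[]=)
open import Function.Base using (_∘_)
open import Function.Bundles using (Inverse; mk↔ₛ′)
open import Level using (0ℓ)
open import Relation.Binary.Definitions using (_Respects_)
open import Relation.Binary.PropositionalEquality
open import Relation.Nullary using (yes; no; does; ¬_; contradiction)
open import Relation.Nullary.Decidable using (dec-true; _×-dec_; ¬?)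
open import Relation.Unary using (Pred; Decidable; Universal)

private
  variable
    n : ℕ

-- Finite subsets and their cardinalities.

comprehension : {P : Pred (Fin n) 0ℓ} → Decidable P → Subset n
comprehension P? = tabulate (does ∘ P?)

module _ {P : Pred (Fin n) 0ℓ} (P? : Decidable P) where

  ∈-comprehension⁺ : ∀ {x} → P x → x ∈ comprehension P?
  ∈-comprehension⁺ {x} px = lookup⇒[]= x _
    (trans (lookup∘tabulate (does ∘ P?) x) (dec-true (P? x) px))

  ∈-comprehension⁻ : ∀ {x} → x ∈ comprehension P? → P x
  ∈-comprehension⁻ {x} x∈ with P? x | trans (sym (lookup∘tabulate (does ∘ P?) x)) ([]=⇒lookup x∈)
  ... | yes px | _ = px
  ... | no _   | ()

preimage : Permutation′ n → Subset n → Subset n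
preimage π S = tabulate (lookup S ∘ (π ⟨$⟩ʳ_))

module _ (π : Permutation′ n) (S : Subset n) where

  ∈-preimage⁺ : ∀ {x} → π ⟨$⟩ʳ x ∈ S → x ∈ preimage π S
  ∈-preimage⁺ {x} πx∈S = lookup⇒[]= x _
    (trans (lookup∘tabulate _ x) ([]=⇒lookup πx∈S))

  ∈-preimage⁻ : ∀ {x} → x ∈ preimage π S → π ⟨$⟩ʳ x ∈ S
  ∈-preimage⁻ {x} x∈ = lookup⇒[]= _ S
    (trans (sym (lookup∘tabulate _ x)) ([]=⇒lookup x∈))

open Sum +-0-commutativeMonoid using (sum; sum-cong-≗; sum-permute)

indicator : Bool → ℕ
indicator true  = 1
indicator false = 0

∣p∣≡sum : (p : Subset n) → ∣ p ∣ ≡ sum (indicator ∘ lookup p)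
∣p∣≡sum []          = refl
∣p∣≡sum (true ∷ p)  = cong suc (∣p∣≡sum p)
∣p∣≡sum (false ∷ p) = ∣p∣≡sum p

∣preimage∣ : ∀ (π : Permutation′ n) S → ∣ preimage π S ∣ ≡ ∣ S ∣
∣preimage∣ {n} π S = begin
  ∣ preimage π S ∣                             ≡⟨ ∣p∣≡sum (preimage π S) ⟩
  sum (indicator ∘ lookup (preimage π S))      ≡⟨ sum-cong-≗ {n = n} (cong indicator ∘ lookup∘tabulate (lookup S ∘ (π ⟨$⟩ʳ_))) ⟩
  sum (indicator ∘ lookup S ∘ (π ⟨$⟩ʳ_))       ≡⟨ sum-permute (indicator ∘ lookup S) π ⟨
  sum (indicator ∘ lookup S)                   ≡⟨ ∣p∣≡sum S ⟨
  ∣ S ∣                                        ∎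
  where open ≡-Reasoning

∣p∪q∣+∣p∩q∣≡∣p∣+∣q∣ : (p q : Subset n) → ∣ p ∪ q ∣ + ∣ p ∩ q ∣ ≡ ∣ p ∣ + ∣ q ∣
∣p∪q∣+∣p∩q∣≡∣p∣+∣q∣ []          []          = refl
∣p∪q∣+∣p∩q∣≡∣p∣+∣q∣ (true ∷ p)  (true ∷ q)  =
  cong suc (trans (+-suc _ _) (trans (cong suc (∣p∪q∣+∣p∩q∣≡∣p∣+∣q∣ p q)) (sym (+-suc _ _))))
∣p∪q∣+∣p∩q∣≡∣p∣+∣q∣ (true ∷ p)  (false ∷ q) = cong suc (∣p∪q∣+∣p∩q∣≡∣p∣+∣q∣ p q)
∣p∪q∣+∣p∩q∣≡∣p∣+∣q∣ (false ∷ p) (true ∷ q)  =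
  trans (cong suc (∣p∪q∣+∣p∩q∣≡∣p∣+∣q∣ p q)) (sym (+-suc _ _))
∣p∪q∣+∣p∩q∣≡∣p∣+∣q∣ (false ∷ p) (false ∷ q) = ∣p∪q∣+∣p∩q∣≡∣p∣+∣q∣ p q

∣p∪q∣≤∣p∣+∣q∣ : (p q : Subset n) → ∣ p ∪ q ∣ ≤ ∣ p ∣ + ∣ q ∣
∣p∪q∣≤∣p∣+∣q∣ p q = ≤-trans (m≤m+n _ _) (≤-reflexive (∣p∪q∣+∣p∩q∣≡∣p∣+∣q∣ p q))

∈⇒∣p∣>0 : ∀ {p : Subset n} {x} → x ∈ p → 0 < ∣ p ∣
∈⇒∣p∣>0 {p = p} {x} x∈p = subst (_≤ ∣ p ∣) (∣⁅x⁆∣≡1 x)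
  (p⊆q⇒∣p∣≤∣q∣ λ y∈ → subst (_∈ p) (sym (x∈⁅y⁆⇒x≡y x y∈)) x∈p)

∣p∣>0⇒Nonempty : ∀ {p : Subset n} → 0 < ∣ p ∣ → Nonempty p
∣p∣>0⇒Nonempty {n} {p} ∣p∣>0 with nonempty? p
... | yes ne = ne
... | no ¬ne = contradiction
      (trans (cong ∣_∣ (Empty-unique ¬ne)) (∣⊥∣≡0 n)) (>⇒≢ ∣p∣>0)

⊆∧≮⇒⊇ : ∀ {p q : Subset n} → p ⊆ q → ¬ ∣ p ∣ < ∣ q ∣ → q ⊆ p
⊆∧≮⇒⊇ {p = p} p⊆q ∣p∣≮∣q∣ {x} x∈q with x ∈? p
... | yes x∈p = x∈p
... | no  x∉p = contradiction (p⊂q⇒∣p∣<∣q∣ (p⊆q , x , x∈q , x∉p)) ∣p∣≮∣q∣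

-- Inequalities between cardinalities, free of division.

-- In `petridis`, p and q are the sizes of X + A + C and X + C, and p′ and q′ the sizes after c
-- joins C; u and v are the overlaps of the old sets with the new translates. Further a = |X + A|, x
-- = |X|, and a′ and x′ are the same for X′.
petridis-arithmetic : ∀ {p p′ q q′ a a′ x x′ u v} →
  p′ + u ≡ p + a → q′ + v ≡ q + x → a′ ≤ u → v ≤ x′ →
  a * x′ ≤ a′ * x → p * x ≤ a * q → p′ * x ≤ a * q′
petridis-arithmetic {p} {p′} {q} {q′} {a} {a′} {x} {x′} {u} {v} eq₁ eq₂ a′≤u v≤x′ ax′≤a′x px≤aq =
  +-cancelʳ-≤ (a′ * x) _ _ (begin
    p′ * x + a′ * x   ≡⟨ *-distribʳ-+ x p′ a′ ⟨
    (p′ + a′) * x     ≤⟨ *-monoˡ-≤ x (+-monoʳ-≤ p′ a′≤u) ⟩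
    (p′ + u) * x      ≡⟨ cong (_* x) eq₁ ⟩
    (p + a) * x       ≡⟨ *-distribʳ-+ x p a ⟩
    p * x + a * x     ≤⟨ +-monoˡ-≤ (a * x) px≤aq ⟩
    a * q + a * x     ≡⟨ *-distribˡ-+ a q x ⟨
    a * (q + x)       ≡⟨ cong (a *_) eq₂ ⟨
    a * (q′ + v)      ≤⟨ *-monoʳ-≤ a (+-monoʳ-≤ q′ v≤x′) ⟩
    a * (q′ + x′)     ≡⟨ *-distribˡ-+ a q′ x′ ⟩
    a * q′ + a * x′   ≤⟨ +-monoʳ-≤ (a * q′) ax′≤a′x ⟩
    a * q′ + a′ * x   ∎)
  where open ≤-Reasoning

^-distribʳ-* : ∀ k m n → (m * n) ^ k ≡ m ^ k * n ^ k
^-distribʳ-* zero    m n = refl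
^-distribʳ-* (suc k) m n =
  trans (cong (m * n *_) (^-distribʳ-* k m n)) (interchange m n (m ^ k) (n ^ k))

-- The bound reads n ≤ (a′ / y) ^ m · y. Neither the growth ratio nor the size decreases in passing
-- from (a′, y) to (a, b).
bound-transfer : ∀ m n {a a′ b y} → 0 < y → y ≤ b → a′ * b ≤ a * y →
                 n * y ^ m ≤ a′ ^ m * y → n * b ^ m ≤ a ^ m * b
bound-transfer m n {a} {a′} {b} {y} 0<y y≤b a′b≤ay ny^m≤ =
  *-cancelʳ-≤ _ _ (y ^ m) {{m^n≢0 y m {{>-nonZero 0<y}}}} (begin
    n * b ^ m * y ^ m     ≡⟨ xy∙z≈xz∙y n (b ^ m) (y ^ m) ⟩
    n * y ^ m * b ^ m     ≤⟨ *-monoˡ-≤ (b ^ m) ny^m≤ ⟩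
    a′ ^ m * y * b ^ m    ≡⟨ xy∙z≈xz∙y (a′ ^ m) y (b ^ m) ⟩
    a′ ^ m * b ^ m * y    ≡⟨ cong (_* y) (^-distribʳ-* m a′ b) ⟨
    (a′ * b) ^ m * y      ≤⟨ *-mono-≤ (^-monoˡ-≤ m a′b≤ay) y≤b ⟩
    (a * y) ^ m * b       ≡⟨ cong (_* b) (^-distribʳ-* m a y) ⟩
    a ^ m * y ^ m * b     ≡⟨ xy∙z≈xz∙y (a ^ m) (y ^ m) b ⟩
    a ^ m * b * y ^ m     ∎)
  where open ≤-Reasoning

-- For positive s and t, the hypotheses say log (n / t) ≤ m / (m + 1) · log (n / s) and log (n / s)
-- < L / M · log n. So each further summand shrinks the logarithmic deficit by the factor m / (m +
-- 1).
growth-step : ∀ n m M L {s t} .{{_ : NonZero n}} .{{_ : NonZero m}} →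
              n * s ^ m ≤ t ^ suc m → n ^ M < s ^ M * n ^ L →
              n ^ (suc m * M) < t ^ (suc m * M) * n ^ (m * L)
growth-step n m M L {s} {t} ns^m≤t n^M< = begin-strict
  n ^ (suc m * M)                        ≡⟨ ^-distribˡ-+-* n M (m * M) ⟩
  n ^ M * n ^ (m * M)                    ≡⟨ cong (n ^ M *_) (^-*-comm n m M) ⟨
  n ^ M * (n ^ M) ^ m                    <⟨ *-monoʳ-< (n ^ M) {{m^n≢0 n M}} (^-monoˡ-< m n^M<) ⟩
  n ^ M * (s ^ M * n ^ L) ^ m            ≡⟨ cong (n ^ M *_) (^-distribʳ-* m (s ^ M) (n ^ L)) ⟩
  n ^ M * ((s ^ M) ^ m * (n ^ L) ^ m)    ≡⟨ *-assoc (n ^ M) ((s ^ M) ^ m) ((n ^ L) ^ m) ⟨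
  n ^ M * (s ^ M) ^ m * (n ^ L) ^ m      ≡⟨ cong₂ (λ x y → n ^ M * x * y)
                                              (trans (^-*-comm s m M) (sym (^-*-assoc s m M)))
                                              (^-*-comm n m L) ⟩
  n ^ M * (s ^ m) ^ M * n ^ (m * L)      ≡⟨ cong (_* n ^ (m * L)) (^-distribʳ-* M n (s ^ m)) ⟨
  (n * s ^ m) ^ M * n ^ (m * L)          ≤⟨ *-monoˡ-≤ (n ^ (m * L)) (^-monoˡ-≤ M ns^m≤t) ⟩
  (t ^ suc m) ^ M * n ^ (m * L)          ≡⟨ cong (_* n ^ (m * L)) (^-*-assoc t (suc m) M) ⟩
  t ^ (suc m * M) * n ^ (m * L)          ∎
  where
  open ≤-Reasoning
  ^-*-comm : ∀ x m M → (x ^ M) ^ m ≡ x ^ (m * M)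
  ^-*-comm x m M = trans (^-*-assoc x M m) (cong (x ^_) (*-comm M m))

half-arithmetic : ∀ n s M L .{{_ : NonZero n}} → 2 * s ≤ n →
                  n ^ M < s ^ M * n ^ L → 2 ^ M < n ^ L
half-arithmetic n s M L 2s≤n n^M< = *-cancelʳ-< (n ^ M) _ _ (begin-strict
  2 ^ M * n ^ M              <⟨ *-monoʳ-< (2 ^ M) {{m^n≢0 2 M}} n^M< ⟩
  2 ^ M * (s ^ M * n ^ L)    ≡⟨ *-assoc (2 ^ M) (s ^ M) (n ^ L) ⟨
  2 ^ M * s ^ M * n ^ L      ≡⟨ cong (_* n ^ L) (^-distribʳ-* M 2 s) ⟨
  (2 * s) ^ M * n ^ L        ≤⟨ *-monoˡ-≤ (n ^ L) (^-monoˡ-≤ M 2s≤n) ⟩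
  n ^ M * n ^ L              ≡⟨ *-comm (n ^ M) (n ^ L) ⟩
  n ^ L * n ^ M              ∎)
  where open ≤-Reasoning

-- Sumsets in an Abelian group on `Fin n`.

module _ {_∙_ : Op₂ (Fin n)} {ε : Fin n} {_⁻¹ : Op₁ (Fin n)}
         (isAbelianGroup : IsAbelianGroup _≡_ _∙_ ε _⁻¹) where

  private
    abelianGroup : AbelianGroup 0ℓ 0ℓ
    abelianGroup = record { isAbelianGroup = isAbelianGroup }

  open IsAbelianGroup isAbelianGroup
    using (isGroup; assoc; comm; identityˡ; identityʳ)
  open IsGroup isGroup using (_//_)
  open AbelianGroupProperties abelianGroup
    using (//-rightDividesˡ; //-rightDividesʳ)

  x//[x//y]≡y : ∀ x y → x // (x // y) ≡ y
  x//[x//y]≡y x y = begin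
    x // (x // y)                    ≡⟨ cong (_// (x // y)) (//-rightDividesˡ y x) ⟨
    ((x // y) ∙ y) // (x // y)       ≡⟨ cong (_// (x // y)) (comm _ _) ⟩
    (y ∙ (x // y)) // (x // y)       ≡⟨ //-rightDividesʳ (x // y) y ⟩
    y                                ∎
    where open ≡-Reasoning

  xy∙z≡xz∙y : ∀ x y z → (x ∙ y) ∙ z ≡ (x ∙ z) ∙ y
  xy∙z≡xz∙y x y z = trans (assoc x y z) (trans (cong (x ∙_) (comm y z)) (sym (assoc x z y)))

  -- The direction x ↦ x - c is chosen so that the preimage of S is S + c.
  translation : Fin n → Permutation′ n
  translation c = mk↔ₛ′ (_// c) (_∙ c) (//-rightDividesʳ c) (//-rightDividesˡ c)

  reflection : Fin n → Permutation′ n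
  reflection g = mk↔ₛ′ (g //_) (g //_) (x//[x//y]≡y g) (x//[x//y]≡y g)

  -- S and g - T, which is `T′`, are too large to be disjoint; a common element is the first
  -- summand.
  pigeonhole : ∀ S T → n < ∣ S ∣ + ∣ T ∣ → ∀ g →
               ∃[ s ] ∃[ t ] s ∈ S × t ∈ T × g ≡ s ∙ t
  pigeonhole S T n<∣S∣+∣T∣ g =
    x , (g // x) , proj₁ x∈ , ∈-preimage⁻ (reflection g) T (proj₂ x∈) ,
    trans (sym (//-rightDividesˡ x g)) (comm _ x)
    where
    T′ = preimage (reflection g) T

    meet : Nonempty (S ∩ T′)
    meet = ∣p∣>0⇒Nonempty (+-cancelˡ-< n 0 _ (begin-strict
      n + 0                    ≡⟨ +-identityʳ n ⟩
      n                        <⟨ n<∣S∣+∣T∣ ⟩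
      ∣ S ∣ + ∣ T ∣            ≡⟨ cong (∣ S ∣ +_) (∣preimage∣ (reflection g) T) ⟨
      ∣ S ∣ + ∣ T′ ∣           ≡⟨ ∣p∪q∣+∣p∩q∣≡∣p∣+∣q∣ S T′ ⟨
      ∣ S ∪ T′ ∣ + ∣ S ∩ T′ ∣  ≤⟨ +-monoˡ-≤ _ (∣p∣≤n (S ∪ T′)) ⟩
      n + ∣ S ∩ T′ ∣           ∎))
      where open ≤-Reasoning

    x = proj₁ meet
    x∈ = x∈p∩q⁻ S T′ (proj₂ meet)

  shift : Fin n → Subset n → Subset n
  shift = preimage ∘ translation

  ∈-shift⁺ : ∀ S c {x} → x ∈ S → x ∙ c ∈ shift c S
  ∈-shift⁺ S c {x} x∈S = ∈-preimage⁺ (translation c) S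
    (subst (_∈ S) (sym (//-rightDividesʳ c x)) x∈S)

  ∈-shift⁻ : ∀ S c {x} → x ∈ shift c S → ∃[ y ] y ∈ S × x ≡ y ∙ c
  ∈-shift⁻ S c {x} x∈ =
    x // c , ∈-preimage⁻ (translation c) S x∈ , sym (//-rightDividesˡ c x)

  -- The sumset of a subset and a list: Petridis' argument adds the elements of
  -- the second summand one at a time.
  infixl 6 _⊕_

  _⊕_ : Subset n → List (Fin n) → Subset n
  S ⊕ []       = ⊥
  S ⊕ (c ∷ cs) = (S ⊕ cs) ∪ shift c S

  ∈-⊕⁺ : ∀ S {cs x c} → x ∈ S → c ∈ᴸ cs → x ∙ c ∈ S ⊕ cs
  ∈-⊕⁺ S {c = c} x∈S (here refl)  = x∈p∪q⁺ (inj₂ (∈-shift⁺ S c x∈S))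
  ∈-⊕⁺ S         x∈S (there c∈cs) = x∈p∪q⁺ (inj₁ (∈-⊕⁺ S x∈S c∈cs))

  ∈-⊕⁻ : ∀ S cs {x} → x ∈ S ⊕ cs → ∃₂ λ y c → y ∈ S × c ∈ᴸ cs × x ≡ y ∙ c
  ∈-⊕⁻ S []       x∈ = contradiction x∈ ∉⊥
  ∈-⊕⁻ S (c ∷ cs) x∈ with x∈p∪q⁻ (S ⊕ cs) (shift c S) x∈
  ... | inj₁ x∈S⊕cs = let y , c′ , y∈S , c′∈cs , eq = ∈-⊕⁻ S cs x∈S⊕cs
                      in y , c′ , y∈S , there c′∈cs , eq
  ... | inj₂ x∈shift = let y , y∈S , eq = ∈-shift⁻ S c x∈shift
                       in y , c , y∈S , here refl , eq

  ⊕-monoˡ : ∀ S T cs → S ⊆ T → S ⊕ cs ⊆ T ⊕ cs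
  ⊕-monoˡ S T cs S⊆T x∈ with _ , _ , y∈S , c∈cs , refl ← ∈-⊕⁻ S cs x∈ = ∈-⊕⁺ T (S⊆T y∈S) c∈cs

  -- Petridis' inequality and its Plünnecke-Ruzsa consequence.

  -- X minimises ∣ Y ⊕ A ∣ / ∣ Y ∣ over the nonempty Y ⊆ X.
  Minimal : List (Fin n) → Subset n → Set
  Minimal A X = ∀ Y → Y ⊆ X → ∣ X ⊕ A ∣ * ∣ Y ∣ ≤ ∣ Y ⊕ A ∣ * ∣ X ∣

  -- When c joins C, the translate X + A + c overlaps the old X + A + C at least in X′ + A + c,
  -- where X′ collects the x with x + A + c already covered. Minimality gives X′ + A its
  -- proportional share of X + A. So the left sumset gains at most |X + A| / |X| times |X| - |X′|,
  -- while X + C gains at least |X| - |X′|.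
  petridis : ∀ A X → Minimal A X → ∀ cs →
             ∣ X ⊕ A ⊕ cs ∣ * ∣ X ∣ ≤ ∣ X ⊕ A ∣ * ∣ X ⊕ cs ∣
  petridis A X minimal [] = ≤-trans (≤-reflexive (cong (_* ∣ X ∣) (∣⊥∣≡0 n))) z≤n
  petridis A X minimal (c ∷ cs) = petridis-arithmetic {p = ∣ P ∣} {a = ∣ X ⊕ A ∣}
    (trans (∣p∪q∣+∣p∩q∣≡∣p∣+∣q∣ P XA+c) (cong (∣ P ∣ +_) (∣preimage∣ (translation c) (X ⊕ A))))
    (trans (∣p∪q∣+∣p∩q∣≡∣p∣+∣q∣ Q X+c) (cong (∣ Q ∣ +_) (∣preimage∣ (translation c) X)))
    ∣X′A∣≤ ∣Q∩X+c∣≤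
    (minimal X′ (proj₁ ∘ ∈-comprehension⁻ X′?))
    (petridis A X minimal cs)
    where
    P = X ⊕ A ⊕ cs
    Q = X ⊕ cs
    XA+c = shift c (X ⊕ A)
    X+c = shift c X

    X′? : Decidable (λ x → x ∈ X × All (λ a → (x ∙ a) ∙ c ∈ P) A)
    X′? x = (x ∈? X) ×-dec all? (λ a → ((x ∙ a) ∙ c) ∈? P) A

    X′ = comprehension X′?

    ∣X′A∣≤ : ∣ X′ ⊕ A ∣ ≤ ∣ P ∩ XA+c ∣
    ∣X′A∣≤ = subst (_≤ ∣ P ∩ XA+c ∣) (∣preimage∣ (translation c) (X′ ⊕ A)) (p⊆q⇒∣p∣≤∣q∣ incl)
      where
      incl : shift c (X′ ⊕ A) ⊆ P ∩ XA+c
      incl x∈ with y , y∈ , refl ← ∈-shift⁻ (X′ ⊕ A) c x∈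
              with x , a , x∈X′ , a∈A , refl ← ∈-⊕⁻ X′ A y∈
        = let x∈X , all = ∈-comprehension⁻ X′? x∈X′
          in x∈p∩q⁺ (All.lookup all a∈A , ∈-shift⁺ (X ⊕ A) c (∈-⊕⁺ X x∈X a∈A))

    ∣Q∩X+c∣≤ : ∣ Q ∩ X+c ∣ ≤ ∣ X′ ∣
    ∣Q∩X+c∣≤ = subst (∣ Q ∩ X+c ∣ ≤_) (∣preimage∣ (translation c) X′) (p⊆q⇒∣p∣≤∣q∣ incl)
      where
      incl : Q ∩ X+c ⊆ shift c X′
      -- If y + c = z + d with d among the earlier elements, then y + a + c = z + a + d is covered
      -- for every a in A, so y lies in X′.
      incl x∈ with x∈Q , x∈X+c ← x∈p∩q⁻ Q X+c x∈
              with y , y∈X , refl ← ∈-shift⁻ X c x∈X+c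
              with z , d , z∈X , d∈cs , y∙c≡z∙d ← ∈-⊕⁻ X cs x∈Q
        = ∈-shift⁺ X′ c (∈-comprehension⁺ X′? (y∈X , All.tabulate λ {a} a∈A →
            subst (_∈ P)
              (trans (xy∙z≡xz∙y z a d) (trans (cong (_∙ a) (sym y∙c≡z∙d)) (xy∙z≡xz∙y y c a)))
              (∈-⊕⁺ (X ⊕ A) (∈-⊕⁺ X z∈X a∈A) d∈cs)))

  singleton-minimal : ∀ A x → Minimal A ⁅ x ⁆
  singleton-minimal A x Y Y⊆⁅x⁆ with nonempty? Y
  ... | no  ¬ne rewrite Empty-unique ¬ne | ∣⊥∣≡0 n | *-zeroʳ ∣ ⁅ x ⁆ ⊕ A ∣ = z≤n
  ... | yes (y , y∈Y) with refl ← x∈⁅y⁆⇒x≡y x (Y⊆⁅x⁆ y∈Y) =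
    *-mono-≤ (p⊆q⇒∣p∣≤∣q∣ (⊕-monoˡ ⁅ x ⁆ Y A ⁅x⁆⊆Y)) (p⊆q⇒∣p∣≤∣q∣ Y⊆⁅x⁆)
    where
    ⁅x⁆⊆Y : ⁅ x ⁆ ⊆ Y
    ⁅x⁆⊆Y z∈ = subst (_∈ Y) (sym (x∈⁅y⁆⇒x≡y x z∈)) y∈Y

  foldSum : ℕ → List (Fin n) → List (Fin n)
  foldSum zero    A = ε ∷ []
  foldSum (suc m) A = cartesianProductWith _∙_ A (foldSum m A)

  Full : List (Fin n) → Set
  Full cs = ∀ x → x ∈ᴸ cs

  ⊕-foldSum-zero : ∀ X A → X ⊕ foldSum 0 A ⊆ X
  ⊕-foldSum-zero X A x∈ with x , _ , x∈X , here refl , refl ← ∈-⊕⁻ X (ε ∷ []) x∈ =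
    subst (_∈ X) (sym (identityʳ x)) x∈X

  ⊕-foldSum-suc : ∀ X A m → X ⊕ foldSum (suc m) A ⊆ X ⊕ A ⊕ foldSum m A
  ⊕-foldSum-suc X A m x∈
    with x , _ , x∈X , c∈ , refl ← ∈-⊕⁻ X (foldSum (suc m) A) x∈
    with a , b , a∈A , b∈ , refl ← ∈-cartesianProductWith⁻ _∙_ A (foldSum m A) c∈
    = subst (_∈ X ⊕ A ⊕ foldSum m A) (assoc x a b) (∈-⊕⁺ (X ⊕ A) (∈-⊕⁺ X x∈X a∈A) b∈)

  ⊕-Full : ∀ X {cs} → Nonempty X → Full cs → n ≤ ∣ X ⊕ cs ∣
  ⊕-Full X {cs} (x , x∈X) full = subst (_≤ ∣ X ⊕ cs ∣) (∣⊤∣≡n n) (p⊆q⇒∣p∣≤∣q∣ incl)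
    where
    incl : ⊤ ⊆ X ⊕ cs
    incl {y} _ = subst (_∈ X ⊕ cs) (trans (comm x (y // x)) (//-rightDividesˡ x y))
                   (∈-⊕⁺ X x∈X (full (y // x)))

  -- Each use of `petridis`, with a fold sum of A as C, strips off one copy of A at the price |X +
  -- A| / |X|. The set X never changes, so its minimality can be reused.
  plünnecke-minimal : ∀ A X → Minimal A X → ∀ m →
                      ∣ X ⊕ foldSum m A ∣ * ∣ X ∣ ^ m ≤ ∣ X ⊕ A ∣ ^ m * ∣ X ∣
  plünnecke-minimal A X minimal zero = begin
    ∣ X ⊕ foldSum 0 A ∣ * 1   ≡⟨ *-identityʳ _ ⟩
    ∣ X ⊕ foldSum 0 A ∣       ≤⟨ p⊆q⇒∣p∣≤∣q∣ (⊕-foldSum-zero X A) ⟩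
    ∣ X ∣                     ≡⟨ *-identityˡ _ ⟨
    1 * ∣ X ∣                 ∎
    where open ≤-Reasoning
  plünnecke-minimal A X minimal (suc m) = begin
    ∣ X ⊕ foldSum (suc m) A ∣ * (x * x ^ m)
      ≤⟨ *-monoˡ-≤ (x * x ^ m) (p⊆q⇒∣p∣≤∣q∣ (⊕-foldSum-suc X A m)) ⟩
    ∣ X ⊕ A ⊕ foldSum m A ∣ * (x * x ^ m)
      ≡⟨ *-assoc ∣ X ⊕ A ⊕ foldSum m A ∣ x (x ^ m) ⟨
    (∣ X ⊕ A ⊕ foldSum m A ∣ * x) * x ^ m
      ≤⟨ *-monoˡ-≤ (x ^ m) (petridis A X minimal (foldSum m A)) ⟩
    (a * ∣ X ⊕ foldSum m A ∣) * x ^ m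
      ≡⟨ *-assoc a ∣ X ⊕ foldSum m A ∣ (x ^ m) ⟩
    a * (∣ X ⊕ foldSum m A ∣ * x ^ m)
      ≤⟨ *-monoʳ-≤ a (plünnecke-minimal A X minimal m) ⟩
    a * (a ^ m * x)
      ≡⟨ *-assoc a (a ^ m) x ⟨
    a * a ^ m * x ∎
    where
    open ≤-Reasoning
    x = ∣ X ∣
    a = ∣ X ⊕ A ∣

  -- If the bound failed for B, the smaller subsets of B, for which it holds,
  -- could not have a smaller growth ratio; so B would be minimal.
  plünnecke : ∀ A m → Full (foldSum m A) → ∀ B → Nonempty B →
              n * ∣ B ∣ ^ m ≤ ∣ B ⊕ A ∣ ^ m * ∣ B ∣
  plünnecke A m full B₀ = go B₀ (<-wellFounded ∣ B₀ ∣)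
    where
    go : ∀ B → Acc _<_ ∣ B ∣ → Nonempty B → n * ∣ B ∣ ^ m ≤ ∣ B ⊕ A ∣ ^ m * ∣ B ∣
    go B (acc rec) B≢∅ with n * ∣ B ∣ ^ m ≤? ∣ B ⊕ A ∣ ^ m * ∣ B ∣
    ... | yes bound  = bound
    ... | no  ¬bound = ≤-trans (*-monoˡ-≤ (∣ B ∣ ^ m) (⊕-Full B B≢∅ full))
                         (plünnecke-minimal A B minimal m)
      where
      minimal : Minimal A B
      minimal Y Y⊆B with ∣ Y ∣ <? ∣ B ∣
      ... | no ∣Y∣≮∣B∣ = *-mono-≤ (p⊆q⇒∣p∣≤∣q∣ (⊕-monoˡ B Y A (⊆∧≮⇒⊇ Y⊆B ∣Y∣≮∣B∣)))
                           (p⊆q⇒∣p∣≤∣q∣ Y⊆B)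
      ... | yes ∣Y∣<∣B∣ = ≮⇒≥ λ better → ¬bound
        (let ∣Y∣>0 = n≢0⇒n>0 (λ ∣Y∣≡0 → n≮0 (subst (∣ Y ⊕ A ∣ * ∣ B ∣ <_)
                       (trans (cong (∣ B ⊕ A ∣ *_) ∣Y∣≡0) (*-zeroʳ ∣ B ⊕ A ∣)) better))
         in bound-transfer m n ∣Y∣>0 (<⇒≤ ∣Y∣<∣B∣) (<⇒≤ better)
              (go Y (rec ∣Y∣<∣B∣) (∣p∣>0⇒Nonempty ∣Y∣>0)))

  plünnecke′ : ∀ A m → Full (foldSum (suc m) A) → ∀ B → Nonempty B →
               n * ∣ B ∣ ^ m ≤ ∣ B ⊕ A ∣ ^ suc m
  plünnecke′ A m full B B≢∅@(_ , x∈B) =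
    *-cancelʳ-≤ _ _ ∣ B ∣ {{>-nonZero (∈⇒∣p∣>0 x∈B)}} (begin
      n * ∣ B ∣ ^ m * ∣ B ∣      ≡⟨ *-assoc n (∣ B ∣ ^ m) ∣ B ∣ ⟩
      n * (∣ B ∣ ^ m * ∣ B ∣)    ≡⟨ cong (n *_) (*-comm (∣ B ∣ ^ m) ∣ B ∣) ⟩
      n * ∣ B ∣ ^ suc m          ≤⟨ plünnecke A (suc m) full B B≢∅ ⟩
      ∣ B ⊕ A ∣ ^ suc m * ∣ B ∣  ∎)
    where open ≤-Reasoning

  -- `⁅ ε ⁆ ⊕ A` is the list `A` as a subset, repetitions discarded, so that its size is meaningful.
  -- The trivial bound for a sumset is thus the case of a singleton X in `petridis`.
  ∣⊕⊕∣≤ : ∀ A cs → ∣ ⁅ ε ⁆ ⊕ A ⊕ cs ∣ ≤ ∣ ⁅ ε ⁆ ⊕ A ∣ * ∣ ⁅ ε ⁆ ⊕ cs ∣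
  ∣⊕⊕∣≤ A cs = subst (_≤ ∣ ⁅ ε ⁆ ⊕ A ∣ * ∣ ⁅ ε ⁆ ⊕ cs ∣)
    (trans (cong (∣ ⁅ ε ⁆ ⊕ A ⊕ cs ∣ *_) (∣⁅x⁆∣≡1 ε)) (*-identityʳ _))
    (petridis A ⁅ ε ⁆ (singleton-minimal A ε) cs)

  -- By commutativity A + A = (A + (A ∖ a)) ∪ {a + a}.
  ∣A+A∣<∣A∣² : ∀ A → 2 ≤ ∣ ⁅ ε ⁆ ⊕ A ∣ → ∣ ⁅ ε ⁆ ⊕ A ⊕ A ∣ < ∣ ⁅ ε ⁆ ⊕ A ∣ * ∣ ⁅ ε ⁆ ⊕ A ∣
  ∣A+A∣<∣A∣² A 2≤∣A∣
    with y , y∈ ← ∣p∣>0⇒Nonempty (≤-trans (s≤s z≤n) 2≤∣A∣)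
    with _ , a , _ , a∈A , refl ← ∈-⊕⁻ ⁅ ε ⁆ A y∈ = begin-strict
    ∣ Y ⊕ A ∣                      ≤⟨ p⊆q⇒∣p∣≤∣q∣ Y⊕A⊆ ⟩
    ∣ (Y ⊕ A⁻) ∪ ⁅ a ∙ a ⁆ ∣       ≤⟨ ∣p∪q∣≤∣p∣+∣q∣ (Y ⊕ A⁻) ⁅ a ∙ a ⁆ ⟩
    ∣ Y ⊕ A⁻ ∣ + ∣ ⁅ a ∙ a ⁆ ∣     ≤⟨ +-mono-≤ (∣⊕⊕∣≤ A A⁻) (≤-reflexive (∣⁅x⁆∣≡1 (a ∙ a))) ⟩
    -- Removing a from the second summand saves a whole row of |A| pairs and costs the single
    -- element a + a.
    ∣ Y ∣ * ∣ Y⁻ ∣ + 1             <⟨ +-monoʳ-< (∣ Y ∣ * ∣ Y⁻ ∣) 2≤∣A∣ ⟩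
    ∣ Y ∣ * ∣ Y⁻ ∣ + ∣ Y ∣         ≡⟨ +-comm _ ∣ Y ∣ ⟩
    ∣ Y ∣ + ∣ Y ∣ * ∣ Y⁻ ∣         ≡⟨ *-suc ∣ Y ∣ ∣ Y⁻ ∣ ⟨
    ∣ Y ∣ * suc ∣ Y⁻ ∣             ≤⟨ *-monoʳ-≤ ∣ Y ∣ (p⊂q⇒∣p∣<∣q∣ Y⁻⊂Y) ⟩
    ∣ Y ∣ * ∣ Y ∣                  ∎
    where
    open ≤-Reasoning
    ≢a? = λ c → ¬? (c Fin.≟ a)
    A⁻ = filter ≢a? A
    Y = ⁅ ε ⁆ ⊕ A
    Y⁻ = ⁅ ε ⁆ ⊕ A⁻

    ε∙∈ : ∀ {cs c} → c ∈ᴸ cs → ε ∙ c ∈ ⁅ ε ⁆ ⊕ cs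
    ε∙∈ = ∈-⊕⁺ ⁅ ε ⁆ (x∈⁅x⁆ ε)

    ε∙∈⁻ : ∀ cs {x} → x ∈ ⁅ ε ⁆ ⊕ cs → x ∈ᴸ cs
    ε∙∈⁻ cs x∈ with z , c , z∈ , c∈cs , refl ← ∈-⊕⁻ ⁅ ε ⁆ cs x∈
      with refl ← x∈⁅y⁆⇒x≡y ε z∈ = subst (_∈ᴸ cs) (sym (identityˡ c)) c∈cs

    Y⊕A⊆ : Y ⊕ A ⊆ (Y ⊕ A⁻) ∪ ⁅ a ∙ a ⁆
    Y⊕A⊆ x∈ with y , c , y∈Y , c∈A , refl ← ∈-⊕⁻ Y A x∈ with c Fin.≟ a
    ... | no c≢a = x∈p∪q⁺ (inj₁ (∈-⊕⁺ Y y∈Y (∈-filter⁺ ≢a? c∈A c≢a)))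
    ... | yes refl with y Fin.≟ a
    ...   | yes refl = x∈p∪q⁺ (inj₂ (x∈⁅x⁆ (a ∙ a)))
    -- Here y + a is rewritten as a + y, whose second summand survives in `A⁻`.
    ...   | no y≢a = x∈p∪q⁺ (inj₁ (subst (_∈ Y ⊕ A⁻)
            (trans (cong (_∙ y) (identityˡ a)) (comm a y))
            (∈-⊕⁺ Y (ε∙∈ a∈A) (∈-filter⁺ ≢a? (ε∙∈⁻ A y∈Y) y≢a))))

    Y⁻⊂Y : Y⁻ ⊂ Y
    Y⁻⊂Y = (λ {x} x∈ → subst (_∈ Y) (identityˡ x)
                 (ε∙∈ (proj₁ (∈-filter⁻ ≢a? {xs = A} (ε∙∈⁻ A⁻ x∈))))) ,
           ε ∙ a , ε∙∈ a∈A ,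
           λ ∈Y⁻ → proj₂ (∈-filter⁻ ≢a? {xs = A} (ε∙∈⁻ A⁻ ∈Y⁻)) (identityˡ a)

  -- Strictness comes from two of the copies; the others enter by the trivial bound. The offset 2 is
  -- essential, as a single copy attains equality.
  ∣foldSum∣<∣A∣^m : ∀ A m → 2 ≤ ∣ ⁅ ε ⁆ ⊕ A ∣ →
                    ∣ ⁅ ε ⁆ ⊕ foldSum (2 + m) A ∣ < ∣ ⁅ ε ⁆ ⊕ A ∣ ^ (2 + m)
  ∣foldSum∣<∣A∣^m A zero 2≤∣A∣ = begin-strict
    ∣ ⁅ ε ⁆ ⊕ foldSum 2 A ∣          ≤⟨ p⊆q⇒∣p∣≤∣q∣ (⊕-foldSum-suc ⁅ ε ⁆ A 1) ⟩
    ∣ ⁅ ε ⁆ ⊕ A ⊕ foldSum 1 A ∣      ≤⟨ p⊆q⇒∣p∣≤∣q∣ (⊕-foldSum-suc (⁅ ε ⁆ ⊕ A) A 0) ⟩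
    ∣ ⁅ ε ⁆ ⊕ A ⊕ A ⊕ foldSum 0 A ∣  ≤⟨ p⊆q⇒∣p∣≤∣q∣ (⊕-foldSum-zero (⁅ ε ⁆ ⊕ A ⊕ A) A) ⟩
    ∣ ⁅ ε ⁆ ⊕ A ⊕ A ∣                <⟨ ∣A+A∣<∣A∣² A 2≤∣A∣ ⟩
    a * a                            ≡⟨ cong (a *_) (*-identityʳ a) ⟨
    a ^ 2                            ∎
    where
    open ≤-Reasoning
    a = ∣ ⁅ ε ⁆ ⊕ A ∣
  ∣foldSum∣<∣A∣^m A (suc m) 2≤∣A∣ = begin-strict
    ∣ ⁅ ε ⁆ ⊕ foldSum (3 + m) A ∣      ≤⟨ p⊆q⇒∣p∣≤∣q∣ (⊕-foldSum-suc ⁅ ε ⁆ A (2 + m)) ⟩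
    ∣ ⁅ ε ⁆ ⊕ A ⊕ foldSum (2 + m) A ∣  ≤⟨ ∣⊕⊕∣≤ A (foldSum (2 + m) A) ⟩
    a * ∣ ⁅ ε ⁆ ⊕ foldSum (2 + m) A ∣  <⟨ *-monoʳ-< a {{>-nonZero (≤-trans (s≤s z≤n) 2≤∣A∣)}}
                                            (∣foldSum∣<∣A∣^m A m 2≤∣A∣) ⟩
    a ^ (3 + m)                        ∎
    where
    open ≤-Reasoning
    a = ∣ ⁅ ε ⁆ ⊕ A ∣

  n<∣A∣^m : 2 ≤ n → ∀ A m → Full (foldSum (2 + m) A) → n < ∣ ⁅ ε ⁆ ⊕ A ∣ ^ (2 + m)
  n<∣A∣^m 2≤n A m full = begin-strict
    n                                  ≤⟨ ⊕-Full ⁅ ε ⁆ (ε , x∈⁅x⁆ ε) full ⟩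
    ∣ ⁅ ε ⁆ ⊕ foldSum (2 + m) A ∣      <⟨ ∣foldSum∣<∣A∣^m A m (≰⇒> ∣A∣≰1) ⟩
    ∣ ⁅ ε ⁆ ⊕ A ∣ ^ (2 + m)            ∎
    where
    open ≤-Reasoning
    -- The weak bound, applied with B = {0}, already excludes |A| ≤ 1, as the strict one requires.
    ∣A∣≰1 : ¬ ∣ ⁅ ε ⁆ ⊕ A ∣ ≤ 1
    ∣A∣≰1 ∣A∣≤1 = <⇒≱ 2≤n (begin
      n                             ≡⟨ *-identityʳ n ⟨
      n * 1                         ≡⟨ cong (n *_) (trans (cong (_^ suc m) (∣⁅x⁆∣≡1 ε)) (^-zeroˡ (suc m))) ⟨
      n * ∣ ⁅ ε ⁆ ∣ ^ suc m         ≤⟨ plünnecke′ A (suc m) full ⁅ ε ⁆ (ε , x∈⁅x⁆ ε) ⟩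
      ∣ ⁅ ε ⁆ ⊕ A ∣ ^ (2 + m)       ≤⟨ ^-monoˡ-≤ (2 + m) ∣A∣≤1 ⟩
      1 ^ (2 + m)                   ≡⟨ ^-zeroˡ (2 + m) ⟩
      1                             ∎)

  -- Growth of iterated sumsets, and covering the group.

  sumsetᴸ : ∀ {k} → Vector (List (Fin n)) k → Subset n
  sumsetᴸ {zero}  A = ⁅ ε ⁆
  sumsetᴸ {suc k} A = sumsetᴸ (tail A) ⊕ head A

  sumsetᴸ-Nonempty : ∀ m {k} (A : Vector (List (Fin n)) k) →
                     (∀ i → Full (foldSum (suc m) (A i))) → Nonempty (sumsetᴸ A)
  sumsetᴸ-Nonempty m {zero}  A full = ε , x∈⁅x⁆ ε
  sumsetᴸ-Nonempty m {suc k} A full =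
    let x , x∈ = sumsetᴸ-Nonempty m (tail A) (full ∘ suc)
        a , _ , a∈ , _ = ∈-cartesianProductWith⁻ _∙_ (head A) (foldSum m (head A)) (full zero ε)
    in x ∙ a , ∈-⊕⁺ (sumsetᴸ (tail A)) x∈ a∈

  sumsetᴸ-++ : ∀ k {l} (A : Vector (List (Fin n)) (k + l)) {x y} →
               x ∈ sumsetᴸ (take k A) → y ∈ sumsetᴸ (drop k A) → x ∙ y ∈ sumsetᴸ A
  sumsetᴸ-++ zero    A {x} {y} x∈ y∈ with refl ← x∈⁅y⁆⇒x≡y ε x∈ =
    subst (_∈ sumsetᴸ A) (sym (identityˡ y)) y∈
  sumsetᴸ-++ (suc k) A {x} {y} x∈ y∈
    with z , a , z∈ , a∈A , refl ← ∈-⊕⁻ (sumsetᴸ (tail (take (suc k) A))) (head A) x∈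
    = subst (_∈ sumsetᴸ A) (xy∙z≡xz∙y z y a)
        (∈-⊕⁺ (sumsetᴸ (tail A)) (sumsetᴸ-++ k (tail A) z∈ y∈) a∈A)

  module _ (2≤n : 2 ≤ n) where

    private instance
      n≢0 : NonZero n
      n≢0 = >-nonZero (≤-trans (s≤s z≤n) 2≤n)

    -- The induction starts at one summand: for the empty sum both sides would equal n. Strictness
    -- is supplied there by `n<∣A∣^m` and preserved by `growth-step`.
    sumset-growth : ∀ m .{{_ : NonZero m}} {k} (A : Vector (List (Fin n)) (suc k)) →
      (∀ i → Full (foldSum (suc m) (A i))) →
      n ^ (suc m ^ suc k) < ∣ sumsetᴸ A ∣ ^ (suc m ^ suc k) * n ^ (m ^ suc k)
    sumset-growth m@(suc m′) {zero} A full = begin-strict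
      n ^ (suc m * 1)                     ≡⟨ cong (n ^_) (*-identityʳ (suc m)) ⟩
      n * n ^ m                           <⟨ *-monoˡ-< (n ^ m) {{m^n≢0 n m}} (n<∣A∣^m 2≤n (A zero) m′ (full zero)) ⟩
      s ^ suc m * n ^ m                   ≡⟨ cong₂ (λ x y → s ^ x * n ^ y) (*-identityʳ (suc m)) (*-identityʳ m) ⟨
      s ^ (suc m * 1) * n ^ (m * 1)       ∎
      where
      open ≤-Reasoning
      s = ∣ sumsetᴸ A ∣
    sumset-growth m {suc k} A full = growth-step n m (suc m ^ suc k) (m ^ suc k)
      (plünnecke′ (head A) m (full zero) (sumsetᴸ (tail A)) (sumsetᴸ-Nonempty m (tail A) (full ∘ suc)))
      (sumset-growth m (tail A) (full ∘ suc))

    -- The cut argument divides by m, so it can refute the power inequality only for positive m. At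
    -- m = 0 every summand is the whole group, and the conclusion follows from n ≥ 2.
    more-than-half : ∀ m {k} (A : Vector (List (Fin n)) (suc k)) →
      (∀ i → Full (foldSum (suc m) (A i))) →
      (.{{_ : NonZero m}} → ¬ 2 ^ (suc m ^ suc k) < n ^ (m ^ suc k)) → n < 2 * ∣ sumsetᴸ A ∣
    more-than-half zero A full _ = begin-strict
      n                  <⟨ m<m*n n 2 (s≤s (s≤s z≤n)) ⟩
      n * 2              ≡⟨ *-comm n 2 ⟩
      2 * n              ≤⟨ *-monoʳ-≤ 2 n≤∣A∣ ⟩
      2 * ∣ sumsetᴸ A ∣  ∎
      where
      open ≤-Reasoning
      n≤∣A∣ : n ≤ ∣ sumsetᴸ A ∣
      n≤∣A∣ = subst₂ _≤_ (*-identityʳ n) (*-identityʳ ∣ sumsetᴸ A ∣)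
        (plünnecke′ (head A) 0 (full zero) (sumsetᴸ (tail A)) (sumsetᴸ-Nonempty 0 (tail A) (full ∘ suc)))
    more-than-half m@(suc _) {k} A full ¬< = ≰⇒> λ 2s≤n → ¬<
      (half-arithmetic n ∣ sumsetᴸ A ∣ (suc m ^ suc k) (m ^ suc k) 2s≤n (sumset-growth m A full))

    sumsetᴸ-covers : ∀ m k (A : Vector (List (Fin n)) (2 * suc k)) →
      (∀ i → Full (foldSum (suc m) (A i))) →
      (.{{_ : NonZero m}} → ¬ 2 ^ (suc m ^ suc k) < n ^ (m ^ suc k)) → ∀ x → x ∈ sumsetᴸ A
    sumsetᴸ-covers m k A full ¬< x =
      let y , z , y∈ , z∈ , x≡y∙z = pigeonhole S T n<∣S∣+∣T∣ x
      in subst (_∈ sumsetᴸ A) (sym x≡y∙z) (sumsetᴸ-++ (suc k) A y∈ z∈)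
      where
      S = sumsetᴸ (take (suc k) A)
      T = sumsetᴸ (drop (suc k) A)

      n<2∣T∣ : n < 2 * ∣ T ∣
      n<2∣T∣ = more-than-half m (drop (suc k) A) (full ∘ (suc k ↑ʳ_))
        -- `2 * suc k` unfolds to `suc k + (suc k + 0)`, so the second half has length
        -- `suc (k + 0)`.
        (subst (λ l → ¬ 2 ^ (suc m ^ suc l) < n ^ (m ^ suc l)) (sym (+-identityʳ k)) ¬<)

      n<∣S∣+∣T∣ : n < ∣ S ∣ + ∣ T ∣
      n<∣S∣+∣T∣ = *-cancelˡ-< 2 n (∣ S ∣ + ∣ T ∣) (begin-strict
        2 * n                        ≡⟨ cong (n +_) (+-identityʳ n) ⟩
        n + n                        <⟨ +-mono-< (more-than-half m (take (suc k) A) (full ∘ (_↑ˡ (suc k + 0))) ¬<) n<2∣T∣ ⟩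
        2 * ∣ S ∣ + 2 * ∣ T ∣        ≡⟨ *-distribˡ-+ 2 (∣ S ∣) (∣ T ∣) ⟨
        2 * (∣ S ∣ + ∣ T ∣)          ∎)
        where open ≤-Reasoning

-- Transfer to an arbitrary group of order n and to arbitrary predicates.

module _ {c ℓ} (G : AbelianGroup c ℓ) {n : ℕ} (order : HasOrder G n) where
  open AbelianGroup G hiding (sym; trans; refl)
  private module G = AbelianGroup G
  open Inverse order using (to; from; to-cong; strictlyInverseˡ; strictlyInverseʳ)
  open Sum commutativeMonoid using () renaming (sum to ∑)

  finRawGroup : RawGroup 0ℓ 0ℓ
  finRawGroup = record
    { Carrier = Fin n
    ; _≈_     = _≡_
    ; _∙_     = λ x y → to (from x ∙ from y)
    ; ε       = to ε
    ; _⁻¹     = λ x → to (from x ⁻¹)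
    }

  open GroupMorphisms finRawGroup rawGroup using (IsGroupMonomorphism)

  from-isGroupMonomorphism : IsGroupMonomorphism from
  from-isGroupMonomorphism = record
    { isGroupHomomorphism = record
      { isMonoidHomomorphism = record
        { isMagmaHomomorphism = record
          { isRelHomomorphism = record { cong = G.reflexive ∘ cong from }
          ; homo = λ x y → strictlyInverseʳ (from x ∙ from y)
          }
        ; ε-homo = strictlyInverseʳ ε
        }
      ; ⁻¹-homo = λ x → strictlyInverseʳ (from x ⁻¹)
      }
    ; injective = λ {x} {y} eq → trans (sym (strictlyInverseˡ x)) (trans (to-cong eq) (strictlyInverseˡ y))
    }

  finIsAbelianGroup : IsAbelianGroup _≡_ (RawGroup._∙_ finRawGroup) (to ε) (RawGroup._⁻¹ finRawGroup)
  finIsAbelianGroup = GroupMonomorphism.isAbelianGroup from-isGroupMonomorphism isAbelianGroup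

  to-sum∈foldSum : ∀ {cs} m (a : Vector Carrier m) → (∀ i → to (a i) ∈ᴸ cs) →
                   to (∑ a) ∈ᴸ foldSum finIsAbelianGroup m cs
  to-sum∈foldSum zero    a a∈cs = here refl
  to-sum∈foldSum {cs} (suc m) a a∈cs = subst (_∈ᴸ foldSum finIsAbelianGroup (suc m) cs)
    (to-cong (∙-cong (strictlyInverseʳ (head a)) (strictlyInverseʳ (∑ (tail a)))))
    (∈-cartesianProductWith⁺ _ (a∈cs zero) (to-sum∈foldSum m (tail a) (a∈cs ∘ suc)))

  sumsetᴸ⊆sumset : ∀ {p k} (A : Vector (Pred Carrier p) k) (cs : Vector (List (Fin n)) k) →
                   (∀ i {c} → c ∈ᴸ cs i → A i (from c)) →
                   ∀ {x} → x ∈ sumsetᴸ finIsAbelianGroup cs → sumset G A (from x)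
  sumsetᴸ⊆sumset {k = zero} A cs cs⊆A {x} x∈ with refl ← x∈⁅y⁆⇒x≡y (to ε) x∈ =
    (λ ()) , (λ ()) , strictlyInverseʳ ε
  sumsetᴸ⊆sumset {k = suc k} A cs cs⊆A x∈
    with y , c , y∈ , c∈ , refl ← ∈-⊕⁻ finIsAbelianGroup (sumsetᴸ finIsAbelianGroup (tail cs)) (head cs) x∈
    with a , a∈A , y≈∑a ← sumsetᴸ⊆sumset (tail A) (tail cs) (cs⊆A ∘ suc) y∈
    = from c Vector.∷ a , (λ { zero → cs⊆A zero c∈ ; (suc i) → a∈A i }) ,
      -- `sumsetᴸ` adds the head on the right, `∑` on the left.
      G.trans (strictlyInverseʳ (from y ∙ from c)) (G.trans (G.comm (from y) (from c)) (∙-cong G.refl y≈∑a))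

  -- The summands in the given representations of all elements of G form a
  -- finite subset of A whose m-fold sumset is still G.
  module _ {p m} {A : Pred Carrier p} (A-resp : A Respects _≈_)
           (mA≡G : Universal (foldSumset G m A)) where

    summand : Fin n → Fin m → Carrier
    summand x = proj₁ (mA≡G (from x))

    summands : List (Fin n)
    summands = cartesianProductWith (λ x j → to (summand x j)) (allFin n) (allFin m)

    summands⊆A : ∀ {x} → x ∈ᴸ summands → A (from x)
    summands⊆A x∈ with y , j , _ , _ , refl ← ∈-cartesianProductWith⁻ _ (allFin n) (allFin m) x∈ =
      A-resp (G.sym (strictlyInverseʳ (summand y j))) (proj₁ (proj₂ (mA≡G (from y))) j)

    foldSum-summands : Full finIsAbelianGroup (foldSum finIsAbelianGroup m summands)
    foldSum-summands x = subst (_∈ᴸ foldSum finIsAbelianGroup m summands)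
      (trans (to-cong (G.sym (proj₂ (proj₂ (mA≡G (from x)))))) (strictlyInverseˡ x))
      (to-sum∈foldSum m (summand x) λ j → ∈-cartesianProductWith⁺ _ (∈-allFin x) (∈-allFin j))

  sumset-covers : 2 ≤ n → ∀ m k {p} (A : Vector (Pred Carrier p) (2 * suc k)) →
    (∀ i → A i Respects _≈_) → (∀ i → Universal (foldSumset G (suc m) (A i))) →
    (.{{_ : NonZero m}} → ¬ 2 ^ (suc m ^ suc k) < n ^ (m ^ suc k)) → Universal (sumset G A)
  sumset-covers 2≤n m k A A-resp mA≡G ¬< g =
    let a , a∈A , ≈∑a = sumsetᴸ⊆sumset A cs (λ i → summands⊆A (A-resp i) (mA≡G i))
          (sumsetᴸ-covers finIsAbelianGroup 2≤n m k cs (λ i → foldSum-summands (A-resp i) (mA≡G i)) ¬< (to g))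
    in a , a∈A , G.trans (G.sym (strictlyInverseʳ g)) ≈∑a
    where
    cs : Vector (List (Fin n)) (2 * suc k)
    cs i = summands (A-resp i) (mA≡G i)

theorem2 : ∀ {c ℓ p} (G : AbelianGroup c ℓ) (N : ℕ) → HasOrder G N → 2 ≤ N →
    (m K : ℕ) .{{_ : NonZero m}} .{{_ : NonZero K}} →
    (A : Fin (2 * K) → Pred (AbelianGroup.Carrier G) p) →
    (∀ i → A i Respects AbelianGroup._≈_ G) →
    (∀ i → Universal (foldSumset G m (A i))) →
    (fromℕ K ≥ᶜ m · ln (log₂ (fromℕ N)) → Universal (sumset G A))
    × (m ≡ 2 → fromℕ K ≥ᶜ log₂ (log₂ (fromℕ N)) → Universal (sumset G A))
theorem2 G N order 2≤N (suc m) (suc k) A A-resp mA≡G =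
  (λ K≥ → covers λ <N → K≱m-ln-log₂ m N (suc k) <N K≥) ,
  (λ { refl K≥ → covers λ <N → K≱log₂-log₂ N (suc k) <N K≥ })
  where
  instance
    N≢0 : NonZero N
    N≢0 = >-nonZero (≤-trans (s≤s z≤n) 2≤N)
  covers : (.{{_ : NonZero m}} → ¬ 2 ^ (suc m ^ suc k) < N ^ (m ^ suc k)) → Universal (sumset G A)
  covers = sumset-covers G order 2≤N m k A A-resp mA≡G
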